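{- Let $D:\mathcal{A}^W\to\mathcal{A}^W$ be a linear operator that is triangular, i.e. $D(\mathcal{A}^W_\lambda)\subseteq\mathcal{A}^W_\lambda$ for every $\lambda\in\mathcal{P}^+$. Let $\{s_\lambda\}_{\lambda\in\mathcal{P}^+}$ be a basis of $\mathcal{A}^W$ such that, for all $\lambda\in\mathcal{P}^+$, $$m_\lambda=\sum_{\mu\in\mathcal{P}^+,\ \mu\preceq\lambda}a_{\lambda\mu}\,s_\mu,\quad a_{\lambda\lambda}=1,\qquad D\,m_\lambda=\sum_{\mu\in\mathcal{P}^+,\ \mu\preceq\lambda}b_{\lambda\mu}\,s_\mu,\quad b_{\lambda\lambda}=\epsilon_\lambda .$$ Assume $D$ is regular: $\epsilon_\mu\neq\epsilon_\lambda$ whenever $\mu,\lambda\in\mathcal{P}^+$ with $\mu\prec\lambda$. Fix $\lambda\in\mathcal{P}^+$ and let $\lambda^{(1)},\lambda^{(2)},\dots,\lambda^{(n)}=\lambda$ be any enumeration of the finite set $\{\mu\in\mathcal{P}^+\mid\mu\preceq\lambda\}$ that refines the partial order (i.e. $\lambda^{(i)}\prec\lambda^{(j)}$ implies $i<j$). Set $\mathcal{E}_\lambda=\prod_{\mu\in\mathcal{P}^+,\ \mu\prec\lambda}(\epsilon_\lambda-\epsilon_\mu)$ and, for $n\ge j>k\ge1$, $d_{\lambda^{(j)}\lambda^{(k)}}=b_{\lambda^{(j)}\lambda^{(k)}}-\epsilon_\lambda\,a_{\lambda^{(j)}\lambda^{(k)}}$. Let $M$ be the $n\times n$ (lower Hessenberg)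 matrix whose first column is $(m_{\lambda^{(1)}},\dots,m_{\lambda^{(n)}})^T$ and whose $(k+1)$-st column, for $k=1,\dots,n-1$, has entry in row $j$ equal to $0$ if $j<k$, equal to $\epsilon_{\lambda^{(k)}}-\epsilon_{\lambda}$ if $j=k$, and equal to $d_{\lambda^{(j)}\lambda^{(k)}}$ if $j>k$. Then $p_\lambda:=\mathcal{E}_\lambda^{ -1}\det M$ satisfies $D p_\lambda=\epsilon_\lambda p_\lambda$ and $p_\lambda=m_\lambda+\sum_{\mu\in\mathcal{P}^+,\ \mu\prec\lambda}c_{\lambda\mu}m_\mu$ for some coefficients $c_{\lambda\mu}$; i.e. $\{p_\lambda\}_{\lambda\in\mathcal{P}^+}$ is the monic basis of $\mathcal{A}^W$ diagonalizing $D$.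
   Context: $E$ is a real Euclidean space with inner product $\langle\cdot,\cdot\rangle$ spanned by an irreducible root system $R$ with Weyl group $W$ and positive roots $R^+$; $\alpha^\vee=2\alpha/\langle\alpha,\alpha\rangle$. $\mathcal{Q}^+=\mathrm{Span}_{\mathbb{N}}(R^+)$; $\mathcal{P}=\{\lambda\in E\mid\langle\lambda,\alpha^\vee\rangle\in\mathbb{Z}\ \forall\alpha\in R\}$ is the weight lattice and $\mathcal{P}^+=\{\lambda\in E\mid\langle\lambda,\alpha^\vee\rangle\in\mathbb{N}\ \forall\alpha\in R^+\}$ the dominant weights; partial order $\lambda\succeq\mu$ iff $\lambda-\mu\in\mathcal{Q}^+$. The group algebra $\mathbb{R}[\mathcal{P}]$ is spanned by formal exponentials $e^\lambda$ ($\lambda\in\mathcal{P}$) with $e^\lambda e^\mu=e^{\lambda+\mu}$, and $\mathcal{A}^W$ is its subspace of $W$-invariant elements, with basis the monomials $m_\lambda=\sum_{\mu\in W(\lambda)}e^\mu$, $\lambda\in\mathcal{P}^+$ ($W(\lambda)$ the $W$-orbit). For $\lambda\in\mathcal{P}^+$, $\mathcal{A}^W_\lambda=\mathrm{Span}\{m_\mu\mid\mu\in\mathcal{P}^+,\ \mu\preceq\lambda\}$. -}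

module Defs where

open import Level using (Level; _⊔_) renaming (suc to lsuc)
open import Algebra.Bundles using (CommutativeMonoid; CommutativeRing; RawRing; AbelianGroup)
open import Algebra.Module.Bundles using (LeftModule)
open import Algebra.Module.Bundles.Raw using (RawLeftModule)
import Algebra.Module.Morphism.Structures as ModuleMorphisms
open import Algebra.Definitions.RawMonoid using (sum)
import Algebra.Definitions.RawMonoid as RawMonoidOps
import Algebra.Definitions.RawSemiring as RawSemiringOps
import Algebra.Properties.AbelianGroup as AbelianGroupProps
import Algebra.Properties.CommutativeSemigroup as CommutativeSemigroupProps
import Algebra.Properties.Group as GroupProps
import Algebra.Properties.Ring as RingProps
import Algebra.Properties.Semiring.Mult as SemiringMult
open import Data.Bool.Base using (if_then_else_)
open import Data.Empty using (⊥-elim)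
open import Data.Fin.Base as Fin using (Fin; zero; suc; toℕ; fromℕ; inject₁; punchIn; funToFin; finToFun)
import Data.Fin.Properties as Fin
open import Data.Fin.Subset using (Subset; Nonempty; ∁) renaming (_∈_ to _∈ₛ_)
open import Data.Integer.Base as ℤ using (ℤ; +_; -[1+_])
import Data.Integer.Properties as ℤ
open import Data.List.Base as List using (List; []; _∷_; _++_; map; length; take; drop; concatMap; allFin; cartesianProductWith; deduplicate)
open import Data.List.Membership.Propositional using () renaming (_∈_ to _∈ₗ_)
import Data.List.Membership.Propositional.Properties as Membershipₚ
import Data.List.Membership.Setoid as MembershipS
import Data.List.Membership.DecSetoid as DecMembershipS
import Data.List.Membership.Setoid.Properties as MembershipSP
import Data.List.Properties as List
open import Data.List.Relation.Unary.All as All using (All; []; _∷_)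
open import Data.List.Relation.Unary.AllPairs using ([]; _∷_)
open import Data.List.Relation.Unary.Any as Any using (here; there)
import Data.List.Relation.Unary.Any.Properties as AnyP
import Data.List.Relation.Unary.Unique.DecSetoid.Properties as UniqueDec
import Data.List.Relation.Unary.Unique.Setoid as UniqueS
open import Data.Nat.Base as ℕ using (ℕ; zero; suc; NonZero)
open import Data.Nat.Induction using (<-wellFounded)
import Data.Nat.Properties as ℕ
open import Data.Product.Base using (∃; Σ-syntax; ∃-syntax; _×_; _,_; proj₁; proj₂)
open import Function.Base using (_∘_; _$_)
open import Function.Definitions using (Injective)
open import Induction.WellFounded using (Acc; acc)
open import Relation.Binary.Bundles using (Setoid; DecSetoid)
open import Relation.Binary.Core using (Rel)
open import Relation.Binary.Definitions using (Decidable; tri<; tri≈; tri>)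
open import Relation.Binary.PropositionalEquality.Core as ≡ using (_≡_; _≢_)
open import Relation.Binary.Structures using (IsStrictTotalOrder)
import Relation.Binary.Reasoning.Setoid as SetoidReasoning
open import Relation.Nullary using (¬_; yes; no; does)
open import Relation.Nullary.Decidable using (map′)
open import Relation.Unary using (Pred)

private
  variable
    c ℓ ℓ₁ ℓ₂ m ℓm i ℓi : Level

-- The classical field of real numbers, up to isomorphism: a Dedekind-complete
-- totally ordered field.  `compare` makes the order and the equality
-- decidable; the value of `0# ⁻¹` is unspecified.
record RealNumbers c ℓ₁ ℓ₂ : Set (lsuc (c ⊔ ℓ₁ ⊔ ℓ₂)) where
  field
    commutativeRing : CommutativeRing c ℓ₁

  open CommutativeRing commutativeRing public hiding (zero)

  infix 4 _<_ _≤_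
  infix 9 _⁻¹

  field
    _<_                : Rel Carrier ℓ₂
    isStrictTotalOrder : IsStrictTotalOrder _≈_ _<_
    0<1                : 0# < 1#
    +-monoˡ-<          : ∀ {x y} z → x < y → x + z < y + z
    *-pos              : ∀ {x y} → 0# < x → 0# < y → 0# < x * y
    _⁻¹                : Carrier → Carrier
    ⁻¹-cong            : ∀ {x y} → x ≈ y → x ⁻¹ ≈ y ⁻¹
    ⁻¹-inverseʳ        : ∀ {x} → ¬ (x ≈ 0#) → x * x ⁻¹ ≈ 1#

  open IsStrictTotalOrder isStrictTotalOrder public
    using (compare; _≟_; _<?_)

  _≤_ : Rel Carrier ℓ₂
  x ≤ y = ¬ (y < x)

  IsUpperBound : ∀ {ℓ} → Pred Carrier ℓ → Pred Carrier (c ⊔ ℓ ⊔ ℓ₂)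
  IsUpperBound S u = ∀ x → S x → x ≤ u

  field
    supremum : (S : Pred Carrier (c ⊔ ℓ₁ ⊔ ℓ₂)) → ∃ S → ∃ (IsUpperBound S) →
               ∃[ u ] IsUpperBound S u × (∀ v → IsUpperBound S v → u ≤ v)

  2# : Carrier
  2# = 1# + 1#

  fromℕ# : ℕ → Carrier
  fromℕ# n = n ×# 1#
    where open RawMonoidOps +-rawMonoid renaming (_×_ to _×#_)

  fromℤ# : ℤ → Carrier
  fromℤ# (+ n)    = fromℕ# n
  fromℤ# -[1+ n ] = - fromℕ# (suc n)

  Integral : Pred Carrier ℓ₁
  Integral x = ∃[ z ] x ≈ fromℤ# z

  Natural : Pred Carrier ℓ₁
  Natural x = ∃[ n ] x ≈ fromℕ# n

module IntegralProperties (ℝ : RealNumbers c ℓ₁ ℓ₂) where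
  open RealNumbers ℝ
  open SetoidReasoning setoid
  open RingProps ring
  open AbelianGroupProps +-abelianGroup using (⁻¹-∙-comm)
  open SemiringMult semiring using (×-homo-+; ×1-homo-*)

  private
    fromℤ#-⊖ : ∀ p q → fromℤ# (p ℤ.⊖ q) ≈ fromℕ# p - fromℕ# q
    fromℤ#-⊖ p       zero    = sym (trans (+-congˡ -0#≈0#) (+-identityʳ _))
    fromℤ#-⊖ zero    (suc q) = sym (+-identityˡ _)
    fromℤ#-⊖ (suc p) (suc q) = begin
      fromℤ# (suc p ℤ.⊖ suc q)                       ≡⟨ ≡.cong fromℤ# (ℤ.[1+m]⊖[1+n]≡m⊖n p q) ⟩
      fromℤ# (p ℤ.⊖ q)                               ≈⟨ fromℤ#-⊖ p q ⟩
      fromℕ# p - fromℕ# q                            ≈⟨ +-identityˡ _ ⟨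
      0# + (fromℕ# p - fromℕ# q)                     ≈⟨ +-congʳ (-‿inverseʳ 1#) ⟨
      (1# - 1#) + (fromℕ# p - fromℕ# q)              ≈⟨ interchange _ _ _ _ ⟩
      (1# + fromℕ# p) + (- 1# - fromℕ# q)            ≈⟨ +-congˡ (⁻¹-∙-comm _ _) ⟩
      (1# + fromℕ# p) - (1# + fromℕ# q)              ∎
      where
      open CommutativeSemigroupProps +-commutativeSemigroup using (interchange)

  Integral-resp : ∀ {x y} → x ≈ y → Integral x → Integral y
  Integral-resp x≈y (z , x≈z) = z , trans (sym x≈y) x≈z

  0-integral : Integral 0#
  0-integral = + 0 , refl

  fromℕ#-integral : ∀ n → Integral (fromℕ# n)
  fromℕ#-integral n = + n , refl

  neg-integral : ∀ {x} → Integral x → Integral (- x)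
  neg-integral (+ zero   , x≈z) = + zero    , trans (-‿cong x≈z) -0#≈0#
  neg-integral (+ suc n  , x≈z) = -[1+ n ]  , -‿cong x≈z
  neg-integral (-[1+ n ] , x≈z) = + suc n   , trans (-‿cong x≈z) (-‿involutive _)

  +-integral : ∀ {x y} → Integral x → Integral y → Integral (x + y)
  +-integral (z , x≈z) (w , y≈w) = z ℤ.+ w , trans (+-cong x≈z y≈w) (sym (homo z w))
    where
    homo : ∀ z w → fromℤ# (z ℤ.+ w) ≈ fromℤ# z + fromℤ# w
    homo (+ p)    (+ q)    = ×-homo-+ 1# p q
    homo (+ p)    -[1+ q ] = fromℤ#-⊖ p (suc q)
    homo -[1+ p ] (+ q)    = trans (fromℤ#-⊖ q (suc p)) (+-comm _ _)
    homo -[1+ p ] -[1+ q ] = begin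
      - fromℕ# (suc (suc (p ℕ.+ q)))            ≡⟨ ≡.cong (-_ ∘ fromℕ#) (≡.sym (ℕ.+-suc (suc p) q)) ⟩
      - fromℕ# (suc p ℕ.+ suc q)                ≈⟨ -‿cong (×-homo-+ 1# (suc p) (suc q)) ⟩
      - (fromℕ# (suc p) + fromℕ# (suc q))       ≈⟨ ⁻¹-∙-comm _ _ ⟨
      - fromℕ# (suc p) - fromℕ# (suc q)         ∎

  *-integral : ∀ {x y} → Integral x → Integral y → Integral (x * y)
  *-integral {x} {y} (z , x≈z) (w , y≈w) = Integral-resp (sym (*-cong x≈z y≈w)) (homo z w)
    where
    natural : ∀ p q → Integral (fromℕ# p * fromℕ# q)
    natural p q = + (p ℕ.* q) , sym (×1-homo-* p q)

    homo : ∀ z w → Integral (fromℤ# z * fromℤ# w)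
    homo (+ p)    (+ q)    = natural p q
    homo (+ p)    -[1+ q ] = Integral-resp (-‿distribʳ-* _ _) (neg-integral (natural p (suc q)))
    homo -[1+ p ] (+ q)    = Integral-resp (-‿distribˡ-* _ _) (neg-integral (natural (suc p) q))
    homo -[1+ p ] -[1+ q ] = Integral-resp
      (-‿distribˡ-* _ _)
      (neg-integral (homo (+ suc p) -[1+ q ]))

record EuclideanSpace (ℝ : RealNumbers c ℓ₁ ℓ₂) m ℓm : Set (c ⊔ ℓ₁ ⊔ ℓ₂ ⊔ lsuc (m ⊔ ℓm)) where
  open RealNumbers ℝ

  field
    leftModule : LeftModule ring m ℓm

  open LeftModule leftModule public

  field
    ⟨_,_⟩       : Carrierᴹ → Carrierᴹ → Carrier
    ⟨⟩-cong     : ∀ {x x′ y y′} → x ≈ᴹ x′ → y ≈ᴹ y′ → ⟨ x , y ⟩ ≈ ⟨ x′ , y′ ⟩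
    ⟨⟩-sym      : ∀ x y → ⟨ x , y ⟩ ≈ ⟨ y , x ⟩
    ⟨⟩-+ˡ       : ∀ x y z → ⟨ x +ᴹ y , z ⟩ ≈ ⟨ x , z ⟩ + ⟨ y , z ⟩
    ⟨⟩-*ˡ       : ∀ r x y → ⟨ r *ₗ x , y ⟩ ≈ r * ⟨ x , y ⟩
    ⟨⟩-nonNeg   : ∀ x → 0# ≤ ⟨ x , x ⟩
    ⟨⟩-definite : ∀ {x} → ⟨ x , x ⟩ ≈ 0# → x ≈ᴹ 0ᴹ

  infixl 6 _-ᴹ_

  _-ᴹ_ : Carrierᴹ → Carrierᴹ → Carrierᴹ
  x -ᴹ y = x +ᴹ -ᴹ y

  coroot : Carrierᴹ → Carrierᴹ
  coroot α = (2# * ⟨ α , α ⟩ ⁻¹) *ₗ α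

  reflect : Carrierᴹ → Carrierᴹ → Carrierᴹ
  reflect α x = x +ᴹ (- ⟨ x , coroot α ⟩) *ₗ α

-- R = { root i }.  Finite-dimensionality of E follows from `spanning`.
-- R is not required to be reduced.
record RootSystem {ℝ : RealNumbers c ℓ₁ ℓ₂} (E : EuclideanSpace ℝ m ℓm) : Set (c ⊔ ℓ₁ ⊔ m ⊔ ℓm) where
  open RealNumbers ℝ
  open EuclideanSpace E

  field
    ∣R∣      : ℕ
    root     : Fin ∣R∣ → Carrierᴹ
    nonzero  : ∀ i → ¬ (root i ≈ᴹ 0ᴹ)
    spanning : ∀ x → Σ[ r ∈ (Fin ∣R∣ → Carrier) ] x ≈ᴹ sum +ᴹ-rawMonoid (λ i → r i *ₗ root i)
    closed   : ∀ i j → ∃[ k ] reflect (root i) (root j) ≈ᴹ root k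
    integral : ∀ i j → Integral ⟨ root j , coroot (root i) ⟩

  Irreducible : Set ℓ₁
  Irreducible = NonZero ∣R∣ ×
    ¬ (Σ[ S ∈ Subset ∣R∣ ] Nonempty S × Nonempty (∁ S) ×
       (∀ {i j} → i ∈ₛ S → j ∈ₛ ∁ S → ⟨ root i , root j ⟩ ≈ 0#))

-- A choice of positive roots: those on the positive side of a hyperplane that
-- contains no root.
record PositiveSystem {ℝ : RealNumbers c ℓ₁ ℓ₂} {E : EuclideanSpace ℝ m ℓm} (R : RootSystem E) : Set (ℓ₁ ⊔ ℓ₂ ⊔ m) where
  open RealNumbers ℝ
  open EuclideanSpace E
  open RootSystem R

  field
    normal  : Carrierᴹ
    regular : ∀ i → ¬ (⟨ root i , normal ⟩ ≈ 0#)

  Positive : Pred (Fin ∣R∣) ℓ₂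
  Positive i = 0# < ⟨ root i , normal ⟩

module EuclideanProperties {ℝ : RealNumbers c ℓ₁ ℓ₂} (E : EuclideanSpace ℝ m ℓm) where
  open RealNumbers ℝ
  open EuclideanSpace E
  open SetoidReasoning ≈ᴹ-setoid
  open RingProps ring using (-0#≈0#; -‿distribʳ-*; -‿distribˡ-*; -‿involutive)
  open AbelianGroupProps +-abelianGroup using (⁻¹-∙-comm)
  open GroupProps +ᴹ-group using (inverseʳ-unique; x∙y⁻¹≈ε⇒x≈y; x≈y⇒x∙y⁻¹≈ε)
  private
    module R = SetoidReasoning setoid

  ⟨⟩-*ʳ : ∀ r x y → ⟨ x , r *ₗ y ⟩ ≈ r * ⟨ x , y ⟩
  ⟨⟩-*ʳ r x y = trans (⟨⟩-sym _ _) (trans (⟨⟩-*ˡ _ _ _) (*-congˡ (⟨⟩-sym _ _)))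

  ⟨0,⟩ : ∀ y → ⟨ 0ᴹ , y ⟩ ≈ 0#
  ⟨0,⟩ y = trans (⟨⟩-cong (≈ᴹ-sym (*ₗ-zeroˡ 0ᴹ)) ≈ᴹ-refl) (trans (⟨⟩-*ˡ _ _ _) (zeroˡ _))

  infix 4 _≟ᴹ_

  _≟ᴹ_ : Decidable _≈ᴹ_
  x ≟ᴹ y = map′ (λ p → x∙y⁻¹≈ε⇒x≈y _ _ (⟨⟩-definite p))
                (λ p → trans (⟨⟩-cong (x≈y⇒x∙y⁻¹≈ε p) (x≈y⇒x∙y⁻¹≈ε p)) (⟨0,⟩ _))
                (⟨ x -ᴹ y , x -ᴹ y ⟩ ≟ 0#)

  -ᴹ≈-1* : ∀ x → -ᴹ x ≈ᴹ (- 1#) *ₗ x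
  -ᴹ≈-1* x = ≈ᴹ-sym $ inverseʳ-unique x _ (begin
    x +ᴹ (- 1#) *ₗ x          ≈⟨ +ᴹ-congʳ (*ₗ-identityˡ x) ⟨
    1# *ₗ x +ᴹ (- 1#) *ₗ x    ≈⟨ *ₗ-distribʳ x _ _ ⟨
    (1# - 1#) *ₗ x            ≈⟨ *ₗ-congʳ (-‿inverseʳ 1#) ⟩
    0# *ₗ x                   ≈⟨ *ₗ-zeroˡ x ⟩
    0ᴹ                        ∎)

  reflect-cong : ∀ α {x y} → x ≈ᴹ y → reflect α x ≈ᴹ reflect α y
  reflect-cong α p = +ᴹ-cong p (*ₗ-congʳ (-‿cong (⟨⟩-cong p ≈ᴹ-refl)))

  reflect-+ : ∀ α x y → reflect α (x +ᴹ y) ≈ᴹ reflect α x +ᴹ reflect α y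
  reflect-+ α x y = begin
    (x +ᴹ y) +ᴹ (- ⟨ x +ᴹ y , α∨ ⟩) *ₗ α
      ≈⟨ +ᴹ-congˡ (*ₗ-congʳ (trans (-‿cong (⟨⟩-+ˡ x y α∨)) (sym (⁻¹-∙-comm _ _)))) ⟩
    (x +ᴹ y) +ᴹ (- ⟨ x , α∨ ⟩ - ⟨ y , α∨ ⟩) *ₗ α
      ≈⟨ +ᴹ-congˡ (*ₗ-distribʳ _ _ _) ⟩
    (x +ᴹ y) +ᴹ ((- ⟨ x , α∨ ⟩) *ₗ α +ᴹ (- ⟨ y , α∨ ⟩) *ₗ α)
      ≈⟨ interchange _ _ _ _ ⟩
    reflect α x +ᴹ reflect α y ∎
    where
    α∨ = coroot α
    open CommutativeSemigroupProps (CommutativeMonoid.commutativeSemigroup +ᴹ-commutativeMonoid)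
      using (interchange)

  reflect-* : ∀ α r x → reflect α (r *ₗ x) ≈ᴹ r *ₗ reflect α x
  reflect-* α r x = begin
    r *ₗ x +ᴹ (- ⟨ r *ₗ x , coroot α ⟩) *ₗ α
      ≈⟨ +ᴹ-congˡ (*ₗ-congʳ (trans (-‿cong (⟨⟩-*ˡ r x _)) (-‿distribʳ-* _ _))) ⟩
    r *ₗ x +ᴹ (r * - ⟨ x , coroot α ⟩) *ₗ α      ≈⟨ +ᴹ-congˡ (*ₗ-assoc _ _ _) ⟩
    r *ₗ x +ᴹ r *ₗ ((- ⟨ x , coroot α ⟩) *ₗ α)   ≈⟨ *ₗ-distribˡ _ _ _ ⟨
    r *ₗ reflect α x                             ∎

  ⟨α,α∨⟩≈2 : ∀ {α} → ¬ (α ≈ᴹ 0ᴹ) → ⟨ α , coroot α ⟩ ≈ 2#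
  ⟨α,α∨⟩≈2 {α} α≉0 = R.begin
    ⟨ α , (2# * ⟨ α , α ⟩ ⁻¹) *ₗ α ⟩    R.≈⟨ ⟨⟩-*ʳ _ _ _ ⟩
    2# * ⟨ α , α ⟩ ⁻¹ * ⟨ α , α ⟩       R.≈⟨ *-assoc _ _ _ ⟩
    2# * (⟨ α , α ⟩ ⁻¹ * ⟨ α , α ⟩)     R.≈⟨ *-congˡ (trans (*-comm _ _) (⁻¹-inverseʳ (α≉0 ∘ ⟨⟩-definite))) ⟩
    2# * 1#                             R.≈⟨ *-identityʳ _ ⟩
    2#                                  R.∎

  reflect-involutive : ∀ {α} → ¬ (α ≈ᴹ 0ᴹ) → ∀ x → reflect α (reflect α x) ≈ᴹ x
  reflect-involutive {α} α≉0 x = begin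
    (x +ᴹ (- a) *ₗ α) +ᴹ (- ⟨ reflect α x , coroot α ⟩) *ₗ α   ≈⟨ +ᴹ-congˡ (*ₗ-congʳ (-‿cong negated)) ⟩
    (x +ᴹ (- a) *ₗ α) +ᴹ (- (- a)) *ₗ α                        ≈⟨ +ᴹ-assoc _ _ _ ⟩
    x +ᴹ ((- a) *ₗ α +ᴹ (- (- a)) *ₗ α)                        ≈⟨ +ᴹ-congˡ (*ₗ-distribʳ _ _ _) ⟨
    x +ᴹ (- a - - a) *ₗ α                                      ≈⟨ +ᴹ-congˡ (*ₗ-congʳ (-‿inverseʳ _)) ⟩
    x +ᴹ 0# *ₗ α                                               ≈⟨ +ᴹ-congˡ (*ₗ-zeroˡ _) ⟩
    x +ᴹ 0ᴹ                                                    ≈⟨ +ᴹ-identityʳ _ ⟩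
    x                                                          ∎
    where
    a = ⟨ x , coroot α ⟩
    negated : ⟨ reflect α x , coroot α ⟩ ≈ - a
    negated = R.begin
      ⟨ x +ᴹ (- a) *ₗ α , coroot α ⟩     R.≈⟨ ⟨⟩-+ˡ _ _ _ ⟩
      a + ⟨ (- a) *ₗ α , coroot α ⟩      R.≈⟨ +-congˡ (trans (⟨⟩-*ˡ _ _ _) (*-congˡ (⟨α,α∨⟩≈2 α≉0))) ⟩
      a + - a * (1# + 1#)                R.≈⟨ +-congˡ (trans (distribˡ _ _ _) (+-cong (*-identityʳ _) (*-identityʳ _))) ⟩
      a + (- a + - a)                    R.≈⟨ +-assoc _ _ _ ⟨
      (a - a) - a                        R.≈⟨ +-congʳ (-‿inverseʳ _) ⟩
      0# - a                             R.≈⟨ +-identityˡ _ ⟩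
      - a                                R.∎

-- The algebra K[G] of a commutative ring K over an abelian group G: formal sums
-- of terms r e^x, identified when all their coefficients agree.
module GroupAlgebra (K : CommutativeRing c ℓ) (G : AbelianGroup i ℓi)
                    (_≟ᴳ_ : Decidable (AbelianGroup._≈_ G)) where
  open CommutativeRing K hiding (zero)
  private
    module G = AbelianGroup G
  open SetoidReasoning setoid

  FormalSum : Set (c ⊔ i)
  FormalSum = List (Carrier × G.Carrier)

  -- evaluate φ (Σ r e^x) = Σ r φ(x)
  evaluate : (G.Carrier → Carrier) → FormalSum → Carrier
  evaluate φ []            = 0#
  evaluate φ ((r , x) ∷ f) = r * φ x + evaluate φ f

  δ : G.Carrier → G.Carrier → Carrier
  δ μ x = if does (x ≟ᴳ μ) then 1# else 0#

  coefficient : G.Carrier → FormalSum → Carrier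
  coefficient μ = evaluate (δ μ)

  infix 4 _≋_
  infixl 6 _⊕_
  infixl 7 _⊛_
  infixr 7 _⊙_

  _≋_ : Rel FormalSum (ℓ ⊔ i)
  f ≋ g = ∀ μ → coefficient μ f ≈ coefficient μ g

  constant : Carrier → FormalSum
  constant r = (r , G.ε) ∷ []

  _⊕_ : FormalSum → FormalSum → FormalSum
  _⊕_ = _++_

  _⊛_ : FormalSum → FormalSum → FormalSum
  _⊛_ = cartesianProductWith (λ (r , x) (s , y) → r * s , x G.∙ y)

  _⊙_ : Carrier → FormalSum → FormalSum
  r ⊙ f = map (λ (s , x) → r * s , x) f

  ⊖_ : FormalSum → FormalSum
  ⊖ f = map (λ (s , x) → - s , x) f

  transport : (G.Carrier → G.Carrier) → FormalSum → FormalSum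
  transport w f = map (λ (r , x) → r , w x) f

  module _ where
    open RingProps ring using (-0#≈0#; -‿distribˡ-*)
    open AbelianGroupProps +-abelianGroup using (⁻¹-∙-comm)
    open CommutativeSemigroupProps +-commutativeSemigroup using (interchange)
    open GroupProps G.group using (//-rightDividesʳ; //-rightDividesˡ)

    δ-cong : ∀ {μ ν x y} → (x G.≈ μ → y G.≈ ν) → (y G.≈ ν → x G.≈ μ) → δ μ x ≈ δ ν y
    δ-cong {μ} {ν} {x} {y} p q with x ≟ᴳ μ | y ≟ᴳ ν
    ... | yes _ | yes _ = refl
    ... | no  _ | no  _ = refl
    ... | yes a | no ¬b = ⊥-elim (¬b (p a))
    ... | no ¬a | yes b = ⊥-elim (¬a (q b))

    δ-congˡ : ∀ {μ x y} → x G.≈ y → δ μ x ≈ δ μ y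
    δ-congˡ x≈y = δ-cong (G.trans (G.sym x≈y)) (G.trans x≈y)

    δ-shift : ∀ μ x y → δ μ (x G.∙ y) ≈ δ (μ G.∙ x G.⁻¹) y
    δ-shift μ x y = δ-cong
      (λ p → G.trans (G.sym (//-rightDividesʳ x y)) (G.∙-congʳ (G.trans (G.comm y x) p)))
      (λ q → G.trans (G.comm x y) (G.trans (G.∙-congʳ q) (//-rightDividesˡ x μ)))

    evaluate-cong : ∀ {φ ψ} → (∀ x → φ x ≈ ψ x) → ∀ f → evaluate φ f ≈ evaluate ψ f
    evaluate-cong p []            = refl
    evaluate-cong p ((r , x) ∷ f) = +-cong (*-congˡ (p x)) (evaluate-cong p f)

    evaluate-⊕ : ∀ φ f g → evaluate φ (f ⊕ g) ≈ evaluate φ f + evaluate φ g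
    evaluate-⊕ φ []            g = sym (+-identityˡ _)
    evaluate-⊕ φ ((r , x) ∷ f) g = trans (+-congˡ (evaluate-⊕ φ f g)) (sym (+-assoc _ _ _))

    evaluate-⊙ : ∀ φ r f → evaluate φ (r ⊙ f) ≈ r * evaluate φ f
    evaluate-⊙ φ r []            = sym (zeroʳ r)
    evaluate-⊙ φ r ((s , x) ∷ f) = trans (+-cong (*-assoc _ _ _) (evaluate-⊙ φ r f)) (sym (distribˡ _ _ _))

    evaluate-⊖ : ∀ φ f → evaluate φ (⊖ f) ≈ - evaluate φ f
    evaluate-⊖ φ []            = sym -0#≈0#
    evaluate-⊖ φ ((s , x) ∷ f) = trans (+-cong (sym (-‿distribˡ-* _ _)) (evaluate-⊖ φ f)) (⁻¹-∙-comm _ _)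

    evaluate-⊛ : ∀ φ f g → evaluate φ (f ⊛ g) ≈ evaluate (λ x → evaluate (λ y → φ (x G.∙ y)) g) f
    evaluate-⊛ φ []            g = refl
    evaluate-⊛ φ ((r , x) ∷ f) g = trans (evaluate-⊕ φ (map _ g) (f ⊛ g)) (+-cong (row g) (evaluate-⊛ φ f g))
      where
      row : ∀ h → evaluate φ (map (λ (s , y) → r * s , x G.∙ y) h) ≈ r * evaluate (λ y → φ (x G.∙ y)) h
      row []            = sym (zeroʳ r)
      row ((s , y) ∷ h) = trans (+-cong (*-assoc _ _ _) (row h)) (sym (distribˡ _ _ _))

    evaluate-transport : ∀ φ w f → evaluate φ (transport w f) ≈ evaluate (φ ∘ w) f
    evaluate-transport φ w []      = refl
    evaluate-transport φ w (_ ∷ f) = +-congˡ (evaluate-transport φ w f)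

    evaluate-swap : ∀ (h : G.Carrier → G.Carrier → Carrier) f g →
      evaluate (λ x → evaluate (h x) g) f ≈ evaluate (λ y → evaluate (λ x → h x y) f) g
    evaluate-swap h []            g = sym (vanish g)
      where
      vanish : ∀ g → evaluate (λ _ → 0#) g ≈ 0#
      vanish []      = refl
      vanish (_ ∷ g) = trans (+-cong (zeroʳ _) (vanish g)) (+-identityˡ _)
    evaluate-swap h ((r , x) ∷ f) g = trans (+-congˡ (evaluate-swap h f g)) (sym (split g))
      where
      ψ = λ y → evaluate (λ x → h x y) f
      split : ∀ g → evaluate (λ y → r * h x y + ψ y) g ≈ r * evaluate (h x) g + evaluate ψ g
      split []            = sym (trans (+-identityʳ _) (zeroʳ _))
      split ((s , y) ∷ g) = begin
        s * (r * h x y + ψ y) + evaluate (λ y → r * h x y + ψ y) g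
          ≈⟨ +-cong (distribˡ _ _ _) (split g) ⟩
        (s * (r * h x y) + s * ψ y) + (r * evaluate (h x) g + evaluate ψ g)
          ≈⟨ interchange _ _ _ _ ⟩
        (s * (r * h x y) + r * evaluate (h x) g) + (s * ψ y + evaluate ψ g)
          ≈⟨ +-congʳ (+-congʳ (trans (sym (*-assoc _ _ _)) (trans (*-congʳ (*-comm s r)) (*-assoc _ _ _)))) ⟩
        (r * (s * h x y) + r * evaluate (h x) g) + (s * ψ y + evaluate ψ g)
          ≈⟨ +-congʳ (distribˡ _ _ _) ⟨
        r * (s * h x y + evaluate (h x) g) + (s * ψ y + evaluate ψ g) ∎

    ⊛-comm : ∀ f g → f ⊛ g ≋ g ⊛ f
    ⊛-comm f g μ = begin
      evaluate (δ μ) (f ⊛ g)                                ≈⟨ evaluate-⊛ _ f g ⟩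
      evaluate (λ x → evaluate (λ y → δ μ (x G.∙ y)) g) f   ≈⟨ evaluate-swap _ f g ⟩
      evaluate (λ y → evaluate (λ x → δ μ (x G.∙ y)) f) g   ≈⟨ evaluate-cong (λ y → evaluate-cong (λ x → δ-congˡ (G.comm x y)) f) g ⟩
      evaluate (λ y → evaluate (λ x → δ μ (y G.∙ x)) f) g   ≈⟨ evaluate-⊛ _ g f ⟨
      evaluate (δ μ) (g ⊛ f)                                ∎

    ⊛-congˡ : ∀ f {g g′} → g ≋ g′ → f ⊛ g ≋ f ⊛ g′
    ⊛-congˡ f {g} {g′} p μ = trans (expand g) (trans (evaluate-cong (λ x → p _) f) (sym (expand g′)))
      where
      expand : ∀ g → evaluate (δ μ) (f ⊛ g) ≈ evaluate (λ x → coefficient (μ G.∙ x G.⁻¹) g) f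
      expand g = trans (evaluate-⊛ _ f g) (evaluate-cong (λ x → evaluate-cong (δ-shift μ x) g) f)

    ⊛-cong : ∀ {f f′ g g′} → f ≋ f′ → g ≋ g′ → f ⊛ g ≋ f′ ⊛ g′
    ⊛-cong {f} {f′} {g} {g′} p q μ = begin
      coefficient μ (f ⊛ g)     ≈⟨ ⊛-congˡ f q μ ⟩
      coefficient μ (f ⊛ g′)    ≈⟨ ⊛-comm f g′ μ ⟩
      coefficient μ (g′ ⊛ f)    ≈⟨ ⊛-congˡ g′ p μ ⟩
      coefficient μ (g′ ⊛ f′)   ≈⟨ ⊛-comm g′ f′ μ ⟩
      coefficient μ (f′ ⊛ g′)   ∎

    ⊕-cong : ∀ {f f′ g g′} → f ≋ f′ → g ≋ g′ → f ⊕ g ≋ f′ ⊕ g′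
    ⊕-cong {f} {f′} {g} {g′} p q μ =
      trans (evaluate-⊕ _ f g) (trans (+-cong (p μ) (q μ)) (sym (evaluate-⊕ _ f′ g′)))

    ⊙-cong : ∀ r {f f′} → f ≋ f′ → r ⊙ f ≋ r ⊙ f′
    ⊙-cong r {f} {f′} p μ = trans (evaluate-⊙ _ r f) (trans (*-congˡ (p μ)) (sym (evaluate-⊙ _ r f′)))

    ⊖-cong : ∀ {f f′} → f ≋ f′ → ⊖ f ≋ ⊖ f′
    ⊖-cong {f} {f′} p μ = trans (evaluate-⊖ _ f) (trans (-‿cong (p μ)) (sym (evaluate-⊖ _ f′)))

    transport-⊕ : ∀ w f g → transport w (f ⊕ g) ≡ transport w f ⊕ transport w g
    transport-⊕ w f g = List.map-++ _ f g

    transport-⊙ : ∀ w r f → transport w (r ⊙ f) ≡ r ⊙ transport w f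
    transport-⊙ w r []      = ≡.refl
    transport-⊙ w r (_ ∷ f) = ≡.cong (_ ∷_) (transport-⊙ w r f)

    transport-⊖ : ∀ w f → transport w (⊖ f) ≡ ⊖ transport w f
    transport-⊖ w []      = ≡.refl
    transport-⊖ w (_ ∷ f) = ≡.cong (_ ∷_) (transport-⊖ w f)

    transport-⊛ : ∀ {w} → (∀ x y → w (x G.∙ y) G.≈ w x G.∙ w y) → ∀ f g →
                  transport w (f ⊛ g) ≋ transport w f ⊛ transport w g
    transport-⊛ {w} homo f g μ = begin
      evaluate (δ μ) (transport w (f ⊛ g))
        ≈⟨ evaluate-transport _ w (f ⊛ g) ⟩
      evaluate (δ μ ∘ w) (f ⊛ g)
        ≈⟨ evaluate-⊛ _ f g ⟩
      evaluate (λ x → evaluate (λ y → δ μ (w (x G.∙ y))) g) f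
        ≈⟨ evaluate-cong (λ x → evaluate-cong (λ y → δ-congˡ (homo x y)) g) f ⟩
      evaluate (λ x → evaluate (λ y → δ μ (w x G.∙ w y)) g) f
        ≈⟨ evaluate-cong (λ x → evaluate-transport _ w g) f ⟨
      evaluate (λ x → evaluate (λ y → δ μ (w x G.∙ y)) (transport w g)) f
        ≈⟨ evaluate-transport _ w f ⟨
      evaluate (λ x → evaluate (λ y → δ μ (x G.∙ y)) (transport w g)) (transport w f)
        ≈⟨ evaluate-⊛ _ (transport w f) (transport w g) ⟨
      evaluate (δ μ) (transport w f ⊛ transport w g) ∎

  -- Σ e^x over a list of group elements
  exponentialSum : List G.Carrier → FormalSum
  exponentialSum = map (1# ,_)

  module _ where
    open UniqueS G.setoid using (Unique)
    open MembershipS G.setoid using (_∈_; _∉_)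

    evaluate-unique-∈ : ∀ {μ xs} → Unique xs → μ ∈ xs → coefficient μ (exponentialSum xs) ≈ 1#
    evaluate-unique-∉ : ∀ {μ xs} → μ ∉ xs → coefficient μ (exponentialSum xs) ≈ 0#

    evaluate-unique-∈ {μ} {x ∷ xs} (x∉ ∷ u) (here μ≈x) with x ≟ᴳ μ
    ... | no x≉μ = ⊥-elim (x≉μ (G.sym μ≈x))
    ... | yes _  = trans (+-cong (*-identityʳ _) (evaluate-unique-∉ μ∉)) (+-identityʳ _)
      where
      μ∉ : μ ∉ xs
      μ∉ μ∈ = All.lookupₛ G.setoid (λ p q r → q (G.trans r (G.sym p))) x∉ μ∈ (G.sym μ≈x)
    evaluate-unique-∈ {μ} {x ∷ xs} (x∉ ∷ u) (there μ∈) with x ≟ᴳ μ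
    ... | yes x≈μ = ⊥-elim (All.lookupₛ G.setoid (λ p q r → q (G.trans r (G.sym p))) x∉ μ∈ x≈μ)
    ... | no _    = trans (+-cong (*-identityˡ _) (evaluate-unique-∈ u μ∈)) (+-identityˡ _)

    evaluate-unique-∉ {μ} {[]}     μ∉ = refl
    evaluate-unique-∉ {μ} {x ∷ xs} μ∉ with x ≟ᴳ μ
    ... | yes x≈μ = ⊥-elim (μ∉ (here (G.sym x≈μ)))
    ... | no _    = trans (+-cong (*-identityˡ _) (evaluate-unique-∉ (μ∉ ∘ there))) (+-identityˡ _)

module Weights {ℝ : RealNumbers c ℓ₁ ℓ₂} {E : EuclideanSpace ℝ m ℓm} (R : RootSystem E) where
  open RealNumbers ℝ
  open EuclideanSpace E
  open EuclideanProperties E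
  open RootSystem R
  open IntegralProperties ℝ

  record Weight : Set (c ⊔ ℓ₁ ⊔ m) where
    constructor weight
    field
      vector   : Carrierᴹ
      integral : ∀ i → Integral ⟨ vector , coroot (root i) ⟩

  open Weight public

  infix 4 _≈ᵂ_ _≟ᵂ_

  _≈ᵂ_ : Rel Weight ℓm
  μ ≈ᵂ ν = vector μ ≈ᴹ vector ν

  _≟ᵂ_ : Decidable _≈ᵂ_
  μ ≟ᵂ ν = vector μ ≟ᴹ vector ν

  weightGroup : AbelianGroup (c ⊔ ℓ₁ ⊔ m) ℓm
  weightGroup = record
    { Carrier        = Weight
    ; _≈_            = _≈ᵂ_
    ; _∙_            = λ μ ν → weight (vector μ +ᴹ vector ν) λ i →
                         Integral-resp (sym (⟨⟩-+ˡ _ _ _)) (+-integral (integral μ i) (integral ν i))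
    ; ε              = weight 0ᴹ λ i → Integral-resp (sym (⟨0,⟩ _)) 0-integral
    ; _⁻¹            = λ μ → weight (-ᴹ vector μ) λ i → Integral-resp
                         (sym (trans (⟨⟩-cong (-ᴹ≈-1* _) ≈ᴹ-refl) (⟨⟩-*ˡ _ _ _)))
                         (*-integral (neg-integral 1-integral) (integral μ i))
    ; isAbelianGroup = record
      { isGroup = record
        { isMonoid = record
          { isSemigroup = record
            { isMagma = record
              { isEquivalence = record { refl = ≈ᴹ-refl ; sym = ≈ᴹ-sym ; trans = ≈ᴹ-trans }
              ; ∙-cong        = +ᴹ-cong
              }
            ; assoc = λ _ _ _ → +ᴹ-assoc _ _ _
            }
          ; identity = (λ _ → +ᴹ-identityˡ _) , (λ _ → +ᴹ-identityʳ _)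
          }
        ; inverse = (λ _ → -ᴹ‿inverseˡ _) , (λ _ → -ᴹ‿inverseʳ _)
        ; ⁻¹-cong = -ᴹ‿cong
        }
      ; comm = λ _ _ → +ᴹ-comm _ _
      }
    }
    where
    1-integral : Integral 1#
    1-integral = Integral-resp (+-identityʳ 1#) (fromℕ#-integral 1)

  weightDecSetoid : DecSetoid (c ⊔ ℓ₁ ⊔ m) ℓm
  weightDecSetoid = record
    { isDecEquivalence = record
      { isEquivalence = AbelianGroup.isEquivalence weightGroup
      ; _≟_           = _≟ᵂ_
      }
    }

  -- Elements of the Weyl group, as products of reflections in roots; two words
  -- represent the same element when they act in the same way.
  Word : Set
  Word = List (Fin ∣R∣)

  act : Word → Carrierᴹ → Carrierᴹ
  act []      x = x
  act (i ∷ w) x = reflect (root i) (act w x)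

  infixr 8 _▷_

  _▷_ : Word → Weight → Weight
  w ▷ μ = weight (act w (vector μ)) (act-integral w)
    where
    act-integral : ∀ w i → Integral ⟨ act w (vector μ) , coroot (root i) ⟩
    act-integral []      i = Weight.integral μ i
    act-integral (j ∷ w) i = Integral-resp
      (sym (trans (⟨⟩-+ˡ _ _ _) (+-congˡ (⟨⟩-*ˡ _ _ _))))
      (+-integral (act-integral w i)
                  (*-integral (neg-integral (act-integral w j)) (RootSystem.integral R i j)))

  act-cong : ∀ w {x y} → x ≈ᴹ y → act w x ≈ᴹ act w y
  act-cong []      p = p
  act-cong (i ∷ w) p = reflect-cong _ (act-cong w p)

  act-+ : ∀ w x y → act w (x +ᴹ y) ≈ᴹ act w x +ᴹ act w y
  act-+ []      x y = ≈ᴹ-refl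
  act-+ (i ∷ w) x y = ≈ᴹ-trans (reflect-cong _ (act-+ w x y)) (reflect-+ _ _ _)

  act-* : ∀ w r x → act w (r *ₗ x) ≈ᴹ r *ₗ act w x
  act-* []      r x = ≈ᴹ-refl
  act-* (i ∷ w) r x = ≈ᴹ-trans (reflect-cong _ (act-* w r x)) (reflect-* _ _ _)

  act-0 : ∀ w → act w 0ᴹ ≈ᴹ 0ᴹ
  act-0 w = ≈ᴹ-trans (act-cong w (≈ᴹ-sym (*ₗ-zeroˡ 0ᴹ))) (≈ᴹ-trans (act-* w 0# 0ᴹ) (*ₗ-zeroˡ _))

  act-++ : ∀ u v x → act (u ++ v) x ≡ act u (act v x)
  act-++ []      v x = ≡.refl
  act-++ (i ∷ u) v x = ≡.cong (reflect (root i)) (act-++ u v x)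

  inverse : ∀ w → ∃[ w′ ] (∀ x → act w′ (act w x) ≈ᴹ x) × (∀ x → act w (act w′ x) ≈ᴹ x)
  inverse []      = [] , (λ _ → ≈ᴹ-refl) , (λ _ → ≈ᴹ-refl)
  inverse (i ∷ w) with w′ , left , right ← inverse w = w′ ++ i ∷ [] ,
    (λ x → ≈ᴹ-trans (≈ᴹ-reflexive (act-++ w′ (i ∷ []) _))
             (≈ᴹ-trans (act-cong w′ (reflect-involutive (nonzero i) _)) (left x))) ,
    (λ x → ≈ᴹ-trans (reflect-cong _ (≈ᴹ-trans (≈ᴹ-reflexive (≡.cong (act w) (act-++ w′ (i ∷ []) x))) (right _)))
             (reflect-involutive (nonzero i) x))

  -- The Weyl group acts on E through its permutations of the roots, so by the
  -- pigeonhole principle words of length at most ∣R∣ ^ ∣R∣ give all its elements.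
  permute : Word → Fin ∣R∣ → Fin ∣R∣
  permute []      j = j
  permute (i ∷ w) j = proj₁ (closed i (permute w j))

  act-root : ∀ w j → act w (root j) ≈ᴹ root (permute w j)
  act-root []      j = ≈ᴹ-refl
  act-root (i ∷ w) j = ≈ᴹ-trans (reflect-cong _ (act-root w j)) (proj₂ (closed i (permute w j)))

  permute⇒act : ∀ u v → (∀ j → permute u j ≡ permute v j) → ∀ x → act u x ≈ᴹ act v x
  permute⇒act u v p x with r , x≈ ← spanning x =
    ≈ᴹ-trans (act-cong u x≈) (≈ᴹ-trans (combination root r agree) (≈ᴹ-sym (act-cong v x≈)))
    where
    agree : ∀ j → act u (root j) ≈ᴹ act v (root j)
    agree j = ≈ᴹ-trans (act-root u j) (≈ᴹ-trans (≈ᴹ-reflexive (≡.cong root (p j))) (≈ᴹ-sym (act-root v j)))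

    Σ′ : ∀ {n} → (Fin n → Carrierᴹ) → Carrierᴹ
    Σ′ = sum +ᴹ-rawMonoid

    combination : ∀ {n} (b : Fin n → Carrierᴹ) (r : Fin n → Carrier) →
                  (∀ j → act u (b j) ≈ᴹ act v (b j)) →
                  act u (Σ′ (λ j → r j *ₗ b j)) ≈ᴹ act v (Σ′ (λ j → r j *ₗ b j))
    combination {zero}  b r q = ≈ᴹ-trans (act-0 u) (≈ᴹ-sym (act-0 v))
    combination {suc n} b r q =
      ≈ᴹ-trans (act-+ u _ _)
        (≈ᴹ-trans (+ᴹ-cong (≈ᴹ-trans (act-* u _ _) (≈ᴹ-trans (*ₗ-congˡ (q zero)) (≈ᴹ-sym (act-* v _ _))))
                           (combination (b ∘ suc) (r ∘ suc) (q ∘ suc)))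
                  (≈ᴹ-sym (act-+ v _ _)))

  words≤ : ℕ → List Word
  words≤ zero    = [] ∷ []
  words≤ (suc n) = [] ∷ concatMap (λ i → map (i ∷_) (words≤ n)) (allFin ∣R∣)

  ∈-words≤ : ∀ {n} w → length w ℕ.≤ n → w ∈ₗ words≤ n
  ∈-words≤ {zero}  []      _         = here ≡.refl
  ∈-words≤ {suc n} []      _         = here ≡.refl
  ∈-words≤ {suc n} (i ∷ w) (ℕ.s≤s p) = there $ Membershipₚ.∈-concatMap⁺ (λ i → map (i ∷_) (words≤ n))
    (Any.map (λ { ≡.refl → Membershipₚ.∈-map⁺ (i ∷_) (∈-words≤ w p) }) (Membershipₚ.∈-allFin i))

  shorten : ∀ w → ∃[ w′ ] length w′ ℕ.≤ ∣R∣ ℕ.^ ∣R∣ × (∀ x → act w x ≈ᴹ act w′ x)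
  shorten w = go w (<-wellFounded (length w))
    where
    shorter : ∀ w (i j : Fin (length w)) → i Fin.< j → length (take (toℕ i) w ++ drop (toℕ j) w) ℕ.< length w
    shorter w i j i<j = begin-strict
      length (take (toℕ i) w ++ drop (toℕ j) w)             ≡⟨ List.length-++ (take (toℕ i) w) ⟩
      length (take (toℕ i) w) ℕ.+ length (drop (toℕ j) w)   ≡⟨ ≡.cong₂ ℕ._+_ (List.length-take (toℕ i) w) (List.length-drop (toℕ j) w) ⟩
      (toℕ i ℕ.⊓ length w) ℕ.+ (length w ℕ.∸ toℕ j)         ≤⟨ ℕ.+-monoˡ-≤ _ (ℕ.m⊓n≤m (toℕ i) (length w)) ⟩
      toℕ i ℕ.+ (length w ℕ.∸ toℕ j)                        <⟨ ℕ.+-monoˡ-< _ i<j ⟩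
      toℕ j ℕ.+ (length w ℕ.∸ toℕ j)                        ≡⟨ ℕ.m+[n∸m]≡n (ℕ.<⇒≤ (Fin.toℕ<n j)) ⟩
      length w                                              ∎
      where open ℕ.≤-Reasoning

    excise : ∀ w (i j : Fin (length w)) → funToFin (permute (drop (toℕ i) w)) ≡ funToFin (permute (drop (toℕ j) w)) →
             ∀ x → act w x ≈ᴹ act (take (toℕ i) w ++ drop (toℕ j) w) x
    excise w i j eq x = begin
      act w x                                            ≡⟨ ≡.cong (λ w → act w x) (≡.sym (List.take++drop≡id (toℕ i) w)) ⟩
      act (take (toℕ i) w ++ drop (toℕ i) w) x           ≡⟨ act-++ (take (toℕ i) w) _ x ⟩
      act (take (toℕ i) w) (act (drop (toℕ i) w) x)      ≈⟨ act-cong (take (toℕ i) w) (permute⇒act (drop (toℕ i) w) (drop (toℕ j) w) pointwise x) ⟩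
      act (take (toℕ i) w) (act (drop (toℕ j) w) x)      ≡⟨ act-++ (take (toℕ i) w) _ x ⟨
      act (take (toℕ i) w ++ drop (toℕ j) w) x           ∎
      where
      open SetoidReasoning ≈ᴹ-setoid
      pointwise : ∀ k → permute (drop (toℕ i) w) k ≡ permute (drop (toℕ j) w) k
      pointwise k = ≡.trans (≡.sym (Fin.finToFun-funToFin (permute (drop (toℕ i) w)) k))
        (≡.trans (≡.cong (λ f → finToFun f k) eq) (Fin.finToFun-funToFin (permute (drop (toℕ j) w)) k))

    go : ∀ w → Acc ℕ._<_ (length w) → ∃[ w′ ] length w′ ℕ.≤ ∣R∣ ℕ.^ ∣R∣ × (∀ x → act w x ≈ᴹ act w′ x)
    go w (acc rec) with length w ℕ.≤? ∣R∣ ℕ.^ ∣R∣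
    ... | yes p = w , p , λ _ → ≈ᴹ-refl
    ... | no ¬p
      with i , j , i<j , eq ← Fin.pigeonhole (ℕ.≰⇒> ¬p) (λ (k : Fin (length w)) → funToFin (permute (drop (toℕ k) w)))
      with w″ , short , same ← go (take (toℕ i) w ++ drop (toℕ j) w) (rec (shorter w i j i<j))
      = w″ , short , λ x → ≈ᴹ-trans (excise w i j eq x) (same x)

  -- The Weyl orbit of μ, without repetitions; see ∈-orbit⁺ and ∈-orbit⁻.
  orbit : Weight → List Weight
  orbit μ = deduplicate _≟ᵂ_ (map (_▷ μ) (words≤ (∣R∣ ℕ.^ ∣R∣)))

  open MembershipS (AbelianGroup.setoid weightGroup) using (_∈_; _∉_)
  open UniqueS (AbelianGroup.setoid weightGroup) using (Unique)

  orbit-unique : ∀ μ → Unique (orbit μ)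
  orbit-unique μ = UniqueDec.deduplicate-! weightDecSetoid _

  ∈-orbit⁺ : ∀ {μ ν} w → ν ≈ᵂ w ▷ μ → ν ∈ orbit μ
  ∈-orbit⁺ {μ} {ν} w p with w′ , short , same ← shorten w =
    MembershipSP.∈-deduplicate⁺ (AbelianGroup.setoid weightGroup) _≟ᵂ_
      (λ {x} {y} {z} q r → ≈ᴹ-trans {vector x} {vector y} {vector z} r (≈ᴹ-sym q)) {z = ν}
      (AnyP.map⁺ (Any.map (λ { ≡.refl → ≈ᴹ-trans p (same (vector μ)) }) (∈-words≤ w′ short)))

  ∈-orbit⁻ : ∀ {μ ν} → ν ∈ orbit μ → ∃[ w ] ν ≈ᵂ w ▷ μ
  ∈-orbit⁻ {μ} {ν} ν∈ = Any.satisfied $ AnyP.map⁻ {f = _▷ μ} $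
    MembershipSP.∈-deduplicate⁻ (AbelianGroup.setoid weightGroup) _≟ᵂ_ (map (_▷ μ) (words≤ (∣R∣ ℕ.^ ∣R∣))) {ν} ν∈

-- The determinant, by cofactor expansion along the first column.
module Determinant (A : RawRing c ℓ) where
  open RawRing A
  open RawSemiringOps rawSemiring using (_^_)

  minor : ∀ {n} → (Fin (suc n) → Fin (suc n) → Carrier) → Fin (suc n) → Fin n → Fin n → Carrier
  minor M j i k = M (punchIn j i) (suc k)

  det : ∀ n → (Fin n → Fin n → Carrier) → Carrier
  det zero    M = 1#
  det (suc n) M = sum +-rawMonoid λ j → (- 1#) ^ toℕ j * (M j zero * det n (minor M j))

module Basis {K : Set c} (_≈ᴷ_ : Rel K ℓ₁) (0# : K) (V : RawLeftModule K m ℓm) (I : Setoid i ℓi) where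
  open RawLeftModule V
  open Setoid I using () renaming (Carrier to Index; _≈_ to _≈ᴵ_)

  combination : ∀ {n} → (Index → Carrierᴹ) → (Fin n → K) → (Fin n → Index) → Carrierᴹ
  combination b r at = sum +ᴹ-rawMonoid λ k → r k *ₗ b (at k)

  record IsBasis (b : Index → Carrierᴹ) : Set (c ⊔ ℓ₁ ⊔ m ⊔ ℓm ⊔ i ⊔ ℓi) where
    field
      independent : ∀ {n} (at : Fin n → Index) → Injective _≡_ _≈ᴵ_ at → ∀ r →
                    combination b r at ≈ᴹ 0ᴹ → ∀ k → r k ≈ᴷ 0#
      spans       : ∀ x → ∃[ n ] Σ[ at ∈ (Fin n → Index) ] Σ[ r ∈ (Fin n → K) ] x ≈ᴹ combination b r at

module WeylInvariants {ℝ : RealNumbers c ℓ₁ ℓ₂} {E : EuclideanSpace ℝ m ℓm} {R : RootSystem E} (R⁺ : PositiveSystem R) where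
  open RealNumbers ℝ
  open EuclideanSpace E
  open RootSystem R
  open PositiveSystem R⁺
  open Weights R
  open GroupAlgebra commutativeRing weightGroup _≟ᵂ_

  record Invariant : Set (c ⊔ ℓ₁ ⊔ m) where
    constructor _,_
    field
      element   : FormalSum
      invariant : ∀ w → transport (w ▷_) element ≋ element

  open Invariant public

  infix  4 _≈ᴬ_
  infixl 6 _+ᴬ_
  infixl 7 _*ᴬ_
  infixr 7 _∙ᴬ_

  _≈ᴬ_ : Rel Invariant (c ⊔ ℓ₁ ⊔ m)
  f ≈ᴬ g = element f ≋ element g

  private
    W-homo : ∀ w x y → w ▷ AbelianGroup._∙_ weightGroup x y ≈ᵂ AbelianGroup._∙_ weightGroup (w ▷ x) (w ▷ y)
    W-homo w x y = act-+ w _ _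

    ≡⇒≋ : ∀ {f g h} → f ≡ g → g ≋ h → f ≋ h
    ≡⇒≋ ≡.refl p = p

  constantᴬ : Carrier → Invariant
  constantᴬ r = constant r , λ w μ → +-congʳ (*-congˡ (δ-congˡ {μ} {w ▷ AbelianGroup.ε weightGroup} {AbelianGroup.ε weightGroup} (act-0 w)))

  _+ᴬ_ : Invariant → Invariant → Invariant
  (f , p) +ᴬ (g , q) = f ⊕ g , λ w → 
    ≡⇒≋ {h = f ⊕ g} (transport-⊕ (w ▷_) f g) (⊕-cong {transport (w ▷_) f} {f} {transport (w ▷_) g} {g} (p w) (q w))

  _*ᴬ_ : Invariant → Invariant → Invariant
  (f , p) *ᴬ (g , q) = f ⊛ g , λ w μ →
    trans (transport-⊛ {w ▷_} (W-homo w) f g μ) 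
      (⊛-cong {transport (w ▷_) f} {f} {transport (w ▷_) g} {g} (p w) (q w) μ)

  _∙ᴬ_ : Carrier → Invariant → Invariant
  r ∙ᴬ (f , p) = r ⊙ f , λ w → 
    ≡⇒≋ {h = r ⊙ f} (transport-⊙ (w ▷_) r f) (⊙-cong r {transport (w ▷_) f} {f} (p w))

  -ᴬ_ : Invariant → Invariant
  -ᴬ (f , p) = ⊖ f , λ w → 
    ≡⇒≋ {h = ⊖ f} (transport-⊖ (w ▷_) f) (⊖-cong {transport (w ▷_) f} {f} (p w))

  0ᴬ : Invariant
  0ᴬ = [] , λ w μ → refl

  𝒜ᵂ : RawRing (c ⊔ ℓ₁ ⊔ m) (c ⊔ ℓ₁ ⊔ m)
  𝒜ᵂ = record
    { _≈_ = _≈ᴬ_ ; _+_ = _+ᴬ_ ; _*_ = _*ᴬ_ ; -_ = -ᴬ_ ; 0# = 0ᴬ ; 1# = constantᴬ 1# }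

  𝒜ᵂ-module : RawLeftModule Carrier (c ⊔ ℓ₁ ⊔ m) (c ⊔ ℓ₁ ⊔ m)
  𝒜ᵂ-module = record
    { _≈ᴹ_ = _≈ᴬ_ ; _+ᴹ_ = _+ᴬ_ ; _*ₗ_ = _∙ᴬ_ ; 0ᴹ = 0ᴬ ; -ᴹ_ = -ᴬ_ }

  orbitSum : Weight → Invariant
  orbitSum κ = exponentialSum (orbit κ) , invariance
    where
    open SetoidReasoning setoid
    open MembershipS (AbelianGroup.setoid weightGroup) using (_∈_)
    open DecMembershipS weightDecSetoid using (_∈?_)

    module _ (w : Word) where
      w⁻¹ : Word
      w⁻¹ = proj₁ (inverse w)

      left : ∀ x → act w⁻¹ (act w x) ≈ᴹ x
      left = proj₁ (proj₂ (inverse w))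

      right : ∀ x → act w (act w⁻¹ x) ≈ᴹ x
      right = proj₂ (proj₂ (inverse w))

      move : ∀ μ → w⁻¹ ▷ μ ∈ orbit κ → μ ∈ orbit κ
      move μ p with u , q ← ∈-orbit⁻ {κ} {w⁻¹ ▷ μ} p = ∈-orbit⁺ {κ} {μ} (w ++ u)
        (≈ᴹ-trans (≈ᴹ-sym (right _)) (≈ᴹ-trans (act-cong w q) (≈ᴹ-reflexive (≡.sym (act-++ w u _)))))

      move⁻ : ∀ μ → μ ∈ orbit κ → w⁻¹ ▷ μ ∈ orbit κ
      move⁻ μ p with u , q ← ∈-orbit⁻ {κ} {μ} p = ∈-orbit⁺ {κ} {w⁻¹ ▷ μ} (w⁻¹ ++ u)
        (≈ᴹ-trans (act-cong w⁻¹ q) (≈ᴹ-reflexive (≡.sym (act-++ w⁻¹ u _))))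

      pull : ∀ μ x → δ μ (w ▷ x) ≈ δ (w⁻¹ ▷ μ) x
      pull μ x = δ-cong {μ} {w⁻¹ ▷ μ} {w ▷ x} {x}
        (λ p → ≈ᴹ-trans (≈ᴹ-sym (left _)) (act-cong w⁻¹ p))
        (λ p → ≈ᴹ-trans (act-cong w p) (right _))

      same : ∀ μ → coefficient (w⁻¹ ▷ μ) (exponentialSum (orbit κ)) ≈ coefficient μ (exponentialSum (orbit κ))
      same μ with μ ∈? orbit κ
      ... | yes p = trans (evaluate-unique-∈ {w⁻¹ ▷ μ} (orbit-unique κ) (move⁻ μ p)) (sym (evaluate-unique-∈ {μ} (orbit-unique κ) p))
      ... | no ¬p = trans (evaluate-unique-∉ {w⁻¹ ▷ μ} (¬p ∘ move μ)) (sym (evaluate-unique-∉ {μ} ¬p))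

    invariance : ∀ w → transport (w ▷_) (exponentialSum (orbit κ)) ≋ exponentialSum (orbit κ)
    invariance w μ = begin
      coefficient μ (transport (w ▷_) (exponentialSum (orbit κ)))    ≈⟨ evaluate-transport (δ μ) (w ▷_) (exponentialSum (orbit κ)) ⟩
      evaluate (δ μ ∘ (w ▷_)) (exponentialSum (orbit κ))             ≈⟨ evaluate-cong (pull w μ) (exponentialSum (orbit κ)) ⟩
      coefficient (proj₁ (inverse w) ▷ μ) (exponentialSum (orbit κ)) ≈⟨ same w μ ⟩
      coefficient μ (exponentialSum (orbit κ))                       ∎

  record DominantWeight : Set (c ⊔ ℓ₁ ⊔ ℓ₂ ⊔ m) where
    field
      toWeight : Weight
      dominant : ∀ i → Positive i → Natural ⟨ vector toWeight , coroot (root i) ⟩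

  open DominantWeight public

  infix 4 _≈ᴾ_ _≼_ _≺_

  _≈ᴾ_ : Rel DominantWeight ℓm
  μ ≈ᴾ ν = toWeight μ ≈ᵂ toWeight ν

  𝒫⁺ : Setoid (c ⊔ ℓ₁ ⊔ ℓ₂ ⊔ m) ℓm
  𝒫⁺ = record
    { Carrier       = DominantWeight
    ; _≈_           = _≈ᴾ_
    ; isEquivalence = record { refl = ≈ᴹ-refl ; sym = ≈ᴹ-sym ; trans = ≈ᴹ-trans }
    }

  𝒬⁺ : Pred Carrierᴹ (ℓ₂ ⊔ ℓm)
  𝒬⁺ x = Σ[ n ∈ (Fin ∣R∣ → ℕ) ] (∀ i → n i ≢ 0 → Positive i) ×
           x ≈ᴹ sum +ᴹ-rawMonoid (λ i → n i ×ᴹ root i)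
    where open RawMonoidOps +ᴹ-rawMonoid using () renaming (_×_ to _×ᴹ_)

  _≼_ : Rel DominantWeight (ℓ₂ ⊔ ℓm)
  μ ≼ κ = 𝒬⁺ (vector (toWeight κ) -ᴹ vector (toWeight μ))

  _≺_ : Rel DominantWeight (ℓ₂ ⊔ ℓm)
  μ ≺ κ = μ ≼ κ × ¬ (μ ≈ᴾ κ)

  monomial : DominantWeight → Invariant
  monomial κ = orbitSum (toWeight κ)

  open Basis _≈_ 0# 𝒜ᵂ-module 𝒫⁺ public

  IsLinear : (Invariant → Invariant) → Set (c ⊔ ℓ₁ ⊔ m)
  IsLinear = ModuleMorphisms.LeftModuleMorphisms.IsLeftModuleHomomorphism 𝒜ᵂ-module 𝒜ᵂ-module

  -- Membership of f in the span of the monomials m_μ with μ ≼ κ.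
  _∈𝒜ᵂ_ : Invariant → DominantWeight → Set (c ⊔ ℓ₁ ⊔ ℓ₂ ⊔ m ⊔ ℓm)
  f ∈𝒜ᵂ κ = ∃[ n ] Σ[ μ ∈ (Fin n → DominantWeight) ] Σ[ r ∈ (Fin n → Carrier) ]
              (∀ k → μ k ≼ κ) × f ≈ᴬ combination monomial r μ

  Triangular : (Invariant → Invariant) → Set (c ⊔ ℓ₁ ⊔ ℓ₂ ⊔ m ⊔ ℓm)
  Triangular D = ∀ κ f → f ∈𝒜ᵂ κ → D f ∈𝒜ᵂ κ

  record Enumerates {n} (at : Fin n → DominantWeight) (κ : DominantWeight) : Set (c ⊔ ℓ₁ ⊔ ℓ₂ ⊔ m ⊔ ℓm) where
    field
      below     : ∀ k → at k ≼ κ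
      complete  : ∀ μ → μ ≼ κ → ∃[ k ] at k ≈ᴾ μ
      injective : Injective _≡_ _≈ᴾ_ at

  -- x κ = Σ_{μ ≼ κ} r κ μ · s μ for every κ.  The coefficients r κ μ with
  -- μ ⋠ κ, which do not occur in the sum, are zero by convention.
  record Expansion (x s : DominantWeight → Invariant) (r : DominantWeight → DominantWeight → Carrier)
                   : Set (c ⊔ ℓ₁ ⊔ ℓ₂ ⊔ m ⊔ ℓm) where
    field
      r-cong  : ∀ {κ κ′ μ μ′} → κ ≈ᴾ κ′ → μ ≈ᴾ μ′ → r κ μ ≈ r κ′ μ′
      r-zero  : ∀ κ μ → ¬ (μ ≼ κ) → r κ μ ≈ 0#
      expands : ∀ κ → ∃[ n ] Σ[ at ∈ (Fin n → DominantWeight) ]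
                  Enumerates at κ × x κ ≈ᴬ combination s (r κ ∘ at) at

  -- λ⁽¹⁾, …, λ⁽ⁿ⁾ with n = suc n-1, indexed from zero.
  record LinearExtension (κ : DominantWeight) : Set (c ⊔ ℓ₁ ⊔ ℓ₂ ⊔ m ⊔ ℓm) where
    field
      n-1        : ℕ
      at         : Fin (suc n-1) → DominantWeight
      enumerates : Enumerates at κ
      last       : at (fromℕ n-1) ≈ᴾ κ
      refines    : ∀ j k → at j ≺ at k → j Fin.< k

    -- As at (fromℕ n-1) ≈ κ, the weights μ ≺ κ are exactly the `strictlyBelow k`.
    strictlyBelow : Fin n-1 → DominantWeight
    strictlyBelow k = at (inject₁ k)

  module Eigenfunction (a b : DominantWeight → DominantWeight → Carrier) (ε : DominantWeight → Carrier)
                       {κ : DominantWeight} (e : LinearExtension κ) where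
    open LinearExtension e
    open Determinant 𝒜ᵂ

    ℰ : Carrier
    ℰ = sum *-rawMonoid λ k → ε κ - ε (strictlyBelow k)

    d : Fin (suc n-1) → Fin n-1 → Carrier
    d j k = b (at j) (strictlyBelow k) - ε κ * a (at j) (strictlyBelow k)

    hessenberg : Fin (suc n-1) → Fin (suc n-1) → Invariant
    hessenberg j zero    = monomial (at j)
    hessenberg j (suc k) with Fin.<-cmp j (inject₁ k)
    ... | tri< _ _ _ = 0ᴬ
    ... | tri≈ _ _ _ = constantᴬ (ε (strictlyBelow k) - ε κ)
    ... | tri> _ _ _ = constantᴬ (d j k)

    p : Invariant
    p = ℰ ⁻¹ ∙ᴬ det (suc n-1) hessenberg

{-# OPTIONS --safe #-}

-- Expanding det M along its first column gives p = Σ_j c_j m_{λ⁽ʲ⁾} with scalar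
-- c_j.  As (D - ε_λ) m_{λ⁽ʲ⁾} = Σ_k d_{jk} s_{λ⁽ᵏ⁾}, applying D - ε_λ replaces the
-- first column of M by a combination of the other columns, so the determinant
-- vanishes.  The cofactor of m_λ is a product of the diagonal entries
-- ε_{λ⁽ᵏ⁾} - ε_λ up to the sign that turns it into ℰ_λ, so p_λ is monic.  Hence
-- p_λ = s_λ + (lower terms), and a unitriangular family over a basis is a basis.
module Submission where

open import Defs
open import Algebra.Bundles using (AbelianGroup; CommutativeMonoid; CommutativeRing; RawRing)
open import Algebra.Definitions.RawMonoid using () renaming (sum to sumᴹ)
import Algebra.Definitions.RawSemiring as RawSemiringOps
open import Algebra.Module.Bundles using (LeftModule)
import Algebra.Module.Morphism.Structures as ModuleMorphisms
open import Algebra.Morphism.Structures using (module RingMorphisms)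
import Algebra.Properties.AbelianGroup as AbelianGroupProps
import Algebra.Properties.CommutativeMonoid.Sum as CommutativeMonoidSum
import Algebra.Properties.CommutativeSemigroup as CommutativeSemigroupProps
import Algebra.Properties.Group as GroupProps
import Algebra.Properties.Monoid.Mult as MonoidMult
import Algebra.Properties.Ring as RingProps
import Algebra.Properties.Semiring.Sum as SemiringSum
open import Algebra.Structures using (IsAbelianGroup)
open import Data.Fin.Base as Fin using (Fin; zero; suc; fromℕ; inject₁; punchIn; punchOut; toℕ)
import Data.Fin.Induction as Fin
import Data.Fin.Properties as Fin
open import Data.List.Base as List using (List; [])
import Data.List.Membership.DecSetoid as DecMembershipS
import Data.List.Membership.Propositional.Properties as Membershipₚ
import Data.List.Membership.Setoid as MembershipS
import Data.List.Membership.Setoid.Properties as MembershipSP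
import Data.List.Properties as List
import Data.List.Relation.Unary.All as All
open import Data.List.Relation.Unary.AllPairs using (_∷_)
import Data.List.Relation.Unary.Any as Any
import Data.List.Relation.Unary.Any.Properties as AnyP
import Data.List.Relation.Unary.Unique.DecSetoid.Properties as UniqueDec
import Data.List.Relation.Unary.Unique.Setoid as UniqueS
open import Data.Nat.Base as ℕ using (ℕ; zero; suc; z≤n; s≤s)
import Data.Nat.Properties as ℕ
open import Data.Product.Base using (Σ-syntax; ∃-syntax; _×_; _,_; proj₁; proj₂)
import Data.Vec.Functional as Vector
open import Function.Base using (_∘_)
open import Function.Definitions using (Injective)
open import Induction.WellFounded using (Acc; Acc-resp-flip-≈; WellFounded; acc; wf⇒asym)
open import Level using (Level; _⊔_)
open import Relation.Binary.Bundles using (DecSetoid; Setoid)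
open import Relation.Binary.Core using (Rel)
open import Relation.Binary.Definitions using (Decidable; tri<; tri≈; tri>)
open import Relation.Binary.PropositionalEquality as ≡ using (_≡_; _≢_)
import Relation.Binary.Reasoning.Setoid as SetoidReasoning
open import Relation.Binary.Structures using (IsStrictTotalOrder)
open import Relation.Nullary using (¬_; contradiction; no; yes)

-- The matrix mixes two rings: its first column lies in `𝒜ᵂ`, all other entries are constants. The
-- cofactors along the first column are therefore scalars, and the linear algebra is done over the
-- coefficient ring with a block `C` of n rows and n - 1 columns; `𝒜ᵂ` comes back only through the
-- homomorphism `constantᴬ`. The column that `C` lacks is the one of `s_λ`, which the shift by ε_λ
-- annihilates. The vanishing of the determinant is drawn from the Hessenberg shape: `C` without its
-- top row and first column has the same shape, and the cofactors of `C` are expressed by those of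
-- the smaller block. A second obstacle is that each expansion brings its own enumeration of the
-- weights below a given one. Expansions are restated over any injective family covering these
-- weights, surplus coefficients being zero, so that several of them can share one family. Linear
-- extensions also supply the well-foundedness of `≺` on which the basis claim rests.

private
  variable
    c ℓ ℓ₁ ℓ₂ i ℓi m ℓm : Level

-- Finite sums and their reindexing.

module FiniteSums (M : CommutativeMonoid c ℓ) where
  open CommutativeMonoid M
  open CommutativeMonoidSum M using (sum; sum-cong-≋; sum-remove; sum-replicate-zero)

  -- The summands are explicit because sums over Fin (suc n) unfold, which
  -- prevents their inference.
  ∑-cong : ∀ {n} (f g : Fin n → Carrier) → (∀ i → f i ≈ g i) → sum f ≈ sum g
  ∑-cong f g = sum-cong-≋ {x = f} {y = g}

  sum-zero : ∀ {n} (f : Fin n → Carrier) → (∀ i → f i ≈ ε) → sum f ≈ ε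
  sum-zero {n} f f≈ε = trans (∑-cong f _ f≈ε) (sum-replicate-zero n)

  sum-single : ∀ {n} (f : Fin n → Carrier) i → (∀ j → j ≢ i → f j ≈ ε) → sum f ≈ f i
  sum-single {suc n} f i rest = trans (sum-remove {i = i} f)
    (trans (∙-congˡ (sum-zero (f ∘ punchIn i) (λ j → rest _ (Fin.punchInᵢ≢i i j)))) (identityʳ _))

  module _ (I : Setoid i ℓi) where
    private
      module I = Setoid I

    -- Induction on the length of `at`: `cover` finds its first index in `at′` at `k₀`, and both are
    -- removed. Whatever remains of `at′` at the end was missed by `at` and contributes `ε`.
    sum-reindex : (f : I.Carrier → Carrier) → (∀ {x y} → x I.≈ y → f x ≈ f y) →
      ∀ {n n′} (at : Fin n → I.Carrier) (at′ : Fin n′ → I.Carrier) →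
      Injective _≡_ I._≈_ at → Injective _≡_ I._≈_ at′ →
      (∀ i → ∃[ k ] at′ k I.≈ at i) →
      (∀ k → (∀ i → ¬ at i I.≈ at′ k) → f (at′ k) ≈ ε) →
      sum (f ∘ at) ≈ sum (f ∘ at′)
    sum-reindex f f-cong {zero} at at′ inj inj′ cover missed =
      sym (sum-zero (f ∘ at′) (λ k → missed k λ ()))
    sum-reindex f f-cong {suc n} {zero} at at′ inj inj′ cover missed with () ← proj₁ (cover zero)
    sum-reindex f f-cong {suc n} {suc n′} at at′ inj inj′ cover missed
      with k₀ , at′k₀≈ ← cover zero = trans
        (∙-cong (f-cong (I.sym at′k₀≈))
                (sum-reindex f f-cong (at ∘ suc) (at′ ∘ punchIn k₀)
                  (Fin.suc-injective ∘ inj) (Fin.punchIn-injective k₀ _ _ ∘ inj′) cover′ missed′))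
        (sym (sum-remove {i = k₀} (f ∘ at′)))
      where
      cover′ : ∀ i → ∃[ k ] at′ (punchIn k₀ k) I.≈ at (suc i)
      cover′ i with k , at′k≈ ← cover (suc i) = punchOut k₀≢k ,
        I.trans (I.reflexive (≡.cong at′ (Fin.punchIn-punchOut k₀≢k))) at′k≈
        where
        k₀≢k : k₀ ≢ k
        k₀≢k ≡.refl = contradiction (inj (I.trans (I.sym at′k₀≈) at′k≈)) λ ()

      missed′ : ∀ k → (∀ i → ¬ at (suc i) I.≈ at′ (punchIn k₀ k)) → f (at′ (punchIn k₀ k)) ≈ ε
      missed′ k ∉tail = missed (punchIn k₀ k) λ where
        zero    p → Fin.punchInᵢ≢i k₀ k (≡.sym (inj′ (I.trans at′k₀≈ p)))
        (suc i) p → ∉tail i p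

-- Cofactors of a lower Hessenberg matrix.

module Cofactors (K : CommutativeRing c ℓ) where
  open CommutativeRing K hiding (zero)
  open Determinant rawRing
  open RawSemiringOps (RawRing.rawSemiring rawRing) using (_^_)
  open CommutativeMonoidSum +-commutativeMonoid using (sum)
  open FiniteSums +-commutativeMonoid using (∑-cong; sum-zero)
  open SemiringSum semiring using (*-distribˡ-sum)
  open RingProps ring using (-‿distribˡ-*; -1*x≈-x)
  open CommutativeSemigroupProps *-commutativeSemigroup using (x∙yz≈y∙xz; x∙yz≈xz∙y)
  open SetoidReasoning setoid

  cofactorTerm : ∀ {n} → (Fin (suc n) → Fin (suc n) → Carrier) → Fin (suc n) → Carrier
  cofactorTerm {n} M j = (- 1#) ^ toℕ j * (M j zero * det n (minor M j))

  det-cong : ∀ {n} {M N : Fin n → Fin n → Carrier} → (∀ i k → M i k ≈ N i k) → det n M ≈ det n N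
  det-cong {zero}  p = refl
  det-cong {suc n} {M} {N} p = ∑-cong (cofactorTerm M) (cofactorTerm N)
    λ j → *-congˡ {x = (- 1#) ^ toℕ j} (*-cong (p j zero)
      (det-cong {M = minor M j} {minor N j} λ i k → p (punchIn j i) (suc k)))

  det-zeroRow : ∀ {n} (M : Fin (suc n) → Fin (suc n) → Carrier) → (∀ k → M zero k ≈ 0#) → det (suc n) M ≈ 0#
  det-zeroRow M row = sum-zero (cofactorTerm M)
    λ j → trans (*-congˡ {x = (- 1#) ^ toℕ j} (vanish M row j)) (zeroʳ _)
    where
    vanish : ∀ {n} (M : Fin (suc n) → Fin (suc n) → Carrier) → (∀ k → M zero k ≈ 0#) →
             ∀ j → M j zero * det n (minor M j) ≈ 0#
    vanish         M row zero    = trans (*-congʳ (row zero)) (zeroˡ _)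
    vanish {suc n} M row (suc j) = trans (*-congˡ (det-zeroRow (minor M (suc j)) (row ∘ suc))) (zeroʳ _)

  -- Every minor except the one at the corner keeps the top row without its corner, which is a zero
  -- row.
  det-topLeft : ∀ {n} (M : Fin (suc n) → Fin (suc n) → Carrier) → (∀ k → M zero (suc k) ≈ 0#) →
                det (suc n) M ≈ M zero zero * det n (minor M zero)
  det-topLeft {n} M row = trans
    (+-cong (*-identityˡ _) (sum-zero (cofactorTerm M ∘ suc)
      λ j → trans (*-congˡ {x = (- 1#) ^ toℕ (suc j)} (vanish M row j)) (zeroʳ _)))
    (+-identityʳ _)
    where
    vanish : ∀ {n} (M : Fin (suc n) → Fin (suc n) → Carrier) → (∀ k → M zero (suc k) ≈ 0#) →
             ∀ (j : Fin n) → M (suc j) zero * det n (minor M (suc j)) ≈ 0#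
    vanish {suc n} M row j = trans (*-congˡ (det-zeroRow (minor M (suc j)) row)) (zeroʳ _)

  LowerTriangular : ∀ {n} → (Fin (suc n) → Fin n → Carrier) → Set ℓ
  LowerTriangular C = ∀ j k → j Fin.< inject₁ k → C j k ≈ 0#

  -- det [ v ∣ C ] = Σ_j cofactor C j · v_j
  cofactor : ∀ {n} → (Fin (suc n) → Fin n → Carrier) → Fin (suc n) → Carrier
  cofactor {n} C j = (- 1#) ^ toℕ j * det n (λ i k → C (punchIn j i) k)

  -- Deleting the top row and the first column preserves the shape; all inductions on cofactors
  -- descend along this block.
  inner : ∀ {n} → (Fin (suc (suc n)) → Fin (suc n) → Carrier) → Fin (suc n) → Fin n → Carrier
  inner C j k = C (suc j) (suc k)

  module _ {n} (C : Fin (suc (suc n)) → Fin (suc n) → Carrier) (C-lower : LowerTriangular C) where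
    inner-lower : LowerTriangular (inner C)
    inner-lower j k j<k = C-lower (suc j) (suc k) (s≤s j<k)

    -- This cofactor is the determinant of `C` without its top row, expanded in turn along its first
    -- column.
    cofactor-zero : cofactor C zero ≈ sum (λ i → cofactor (inner C) i * C (suc i) zero)
    cofactor-zero = trans (*-identityˡ _)
      (∑-cong (cofactorTerm λ i → C (suc i)) (λ i → cofactor (inner C) i * C (suc i) zero) λ i →
        x∙yz≈xz∙y ((- 1#) ^ toℕ i) (C (suc i) zero) (det n (λ l k → inner C (punchIn i l) k)))

    -- Deleting a lower row keeps the top one, in which only the corner can be nonzero, so
    -- `det-topLeft` applies. The minus is the sign of row `suc j` relative to row `j`.
    cofactor-suc : ∀ j → cofactor C (suc j) ≈ - C zero zero * cofactor (inner C) j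
    cofactor-suc j = begin
      - 1# * s * det (suc n) (λ i k → C (punchIn (suc j) i) k)
        ≈⟨ *-congˡ (det-topLeft (λ i k → C (punchIn (suc j) i) k) λ k → C-lower zero (suc k) (s≤s z≤n)) ⟩
      - 1# * s * (C zero zero * Δ)    ≈⟨ x∙yz≈y∙xz _ _ _ ⟩
      C zero zero * (- 1# * s * Δ)    ≈⟨ *-congˡ (*-assoc _ _ _) ⟩
      C zero zero * (- 1# * (s * Δ))  ≈⟨ x∙yz≈y∙xz _ _ _ ⟩
      - 1# * (C zero zero * (s * Δ))  ≈⟨ -1*x≈-x _ ⟩
      - (C zero zero * (s * Δ))       ≈⟨ -‿distribˡ-* _ _ ⟩
      - C zero zero * (s * Δ)         ∎
      where
      s = (- 1#) ^ toℕ j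
      Δ = det n (λ i k → inner C (punchIn j i) k)

  -- The two sides of the recursion for `cofactor C` cancel for the first
  -- column of C; its other columns have a zero on top.
  cofactor-annihilates : ∀ {n} (C : Fin (suc n) → Fin n → Carrier) → LowerTriangular C →
                         ∀ k → sum (λ j → cofactor C j * C j k) ≈ 0#
  cofactor-annihilates {suc n} C C-lower k = begin
    cofactor C zero * C zero k + sum (λ j → cofactor C (suc j) * C (suc j) k)
      ≈⟨ +-congˡ (∑-cong (λ j → cofactor C (suc j) * C (suc j) k) (λ j → - C zero zero * term k j)
           λ j → trans (*-congʳ (cofactor-suc C C-lower j)) (*-assoc _ _ _)) ⟩
    cofactor C zero * C zero k + sum (λ j → - C zero zero * term k j)
      ≈⟨ +-congˡ (*-distribˡ-sum _ (term k)) ⟨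
    cofactor C zero * C zero k + - C zero zero * sum (term k)
      ≈⟨ column k ⟩
    0# ∎
    where
    term : Fin (suc n) → Fin (suc n) → Carrier
    term k j = cofactor (inner C) j * C (suc j) k

    column : ∀ k → cofactor C zero * C zero k + - C zero zero * sum (term k) ≈ 0#
    column zero = begin
      cofactor C zero * C zero zero + - C zero zero * sum (term zero)
        ≈⟨ +-cong (trans (*-congʳ (cofactor-zero C C-lower)) (*-comm _ _)) (sym (-‿distribˡ-* _ _)) ⟩
      C zero zero * sum (term zero) - C zero zero * sum (term zero)
        ≈⟨ -‿inverseʳ _ ⟩
      0# ∎
    column (suc k) = trans
      (+-cong (trans (*-congˡ (C-lower zero (suc k) (s≤s z≤n))) (zeroʳ _))
              (trans (*-congˡ (cofactor-annihilates (inner C) (inner-lower C C-lower) k)) (zeroʳ _)))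
      (+-identityʳ _)

  -- Iterating `cofactor-suc` peels off one corner at a time. The sign of the last row is thereby
  -- spread over the n factors of the product, one minus each, which later turns them into the
  -- factors of `ℰ`.
  cofactor-last : ∀ {n} (C : Fin (suc n) → Fin n → Carrier) → LowerTriangular C →
                  cofactor C (fromℕ n) ≈ sumᴹ *-rawMonoid (λ k → - C (inject₁ k) k)
  cofactor-last {zero}  C C-lower = *-identityˡ _
  cofactor-last {suc n} C C-lower = trans (cofactor-suc C C-lower (fromℕ n))
    (*-congˡ (cofactor-last (inner C) (inner-lower C C-lower)))

-- Determinants under a ring homomorphism.

module DeterminantHomomorphism
  (K : CommutativeRing c ℓ) (A : CommutativeRing m ℓm) {φ : CommutativeRing.Carrier K → CommutativeRing.Carrier A}
  (φ-homo : RingMorphisms.IsRingHomomorphism (CommutativeRing.rawRing K) (CommutativeRing.rawRing A) φ) where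
  private
    module K = CommutativeRing K
    module A = CommutativeRing A
    module DetK = Determinant K.rawRing
    module DetA = Determinant A.rawRing
    module CK = Cofactors K
    module CA = Cofactors A
    _^K_ = RawSemiringOps._^_ (RawRing.rawSemiring K.rawRing)
    _^A_ = RawSemiringOps._^_ (RawRing.rawSemiring A.rawRing)
  open RingMorphisms.IsRingHomomorphism φ-homo
  open FiniteSums A.+-commutativeMonoid using (∑-cong)
  open CommutativeSemigroupProps A.*-commutativeSemigroup using (x∙yz≈xz∙y)
  open SetoidReasoning A.setoid

  sign-homo : ∀ n → φ ((K.- K.1#) ^K n) A.≈ (A.- A.1#) ^A n
  sign-homo zero    = 1#-homo
  sign-homo (suc n) = A.trans (*-homo _ _) (A.*-cong (A.trans (-‿homo _) (A.-‿cong 1#-homo)) (sign-homo n))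

  sum-homo : ∀ {n} (f : Fin n → K.Carrier) → φ (sumᴹ K.+-rawMonoid f) A.≈ sumᴹ A.+-rawMonoid (φ ∘ f)
  sum-homo {zero}  f = 0#-homo
  sum-homo {suc n} f = A.trans (+-homo _ _) (A.+-congˡ (sum-homo (f ∘ suc)))

  det-homo : ∀ n (M : Fin n → Fin n → K.Carrier) → φ (DetK.det n M) A.≈ DetA.det n (λ i k → φ (M i k))
  det-homo zero    M = 1#-homo
  det-homo (suc n) M = A.trans (sum-homo (CK.cofactorTerm M))
    (∑-cong (λ j → φ (CK.cofactorTerm M j)) (CA.cofactorTerm (λ i k → φ (M i k))) λ j →
      A.trans (*-homo _ _) (A.*-cong (sign-homo (toℕ j))
        (A.trans (*-homo _ _) (A.*-congˡ (det-homo n (DetK.minor M j))))))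

  -- The minors along the first column do not meet that column, so they are images of determinants
  -- over `K`.
  det-bordered : ∀ {n} (M : Fin (suc n) → Fin (suc n) → A.Carrier) (C : Fin (suc n) → Fin n → K.Carrier) →
    (∀ j k → M j (suc k) A.≈ φ (C j k)) →
    DetA.det (suc n) M A.≈ sumᴹ A.+-rawMonoid (λ j → φ (CK.cofactor C j) A.* M j zero)
  det-bordered {n} M C M≈C = ∑-cong (CA.cofactorTerm M) (λ j → φ (CK.cofactor C j) A.* M j zero) λ j → begin
    sign j A.* (M j zero A.* DetA.det n (DetA.minor M j))
      ≈⟨ A.*-congˡ (A.*-congˡ (CA.det-cong λ i k → M≈C (punchIn j i) k)) ⟩
    sign j A.* (M j zero A.* DetA.det n (λ i k → φ (C (punchIn j i) k)))
      ≈⟨ A.*-cong (sign-homo (toℕ j)) (A.*-congˡ (det-homo n (λ i k → C (punchIn j i) k))) ⟨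
    φ ((K.- K.1#) ^K toℕ j) A.* (M j zero A.* φ (DetK.det n (λ i k → C (punchIn j i) k)))
      ≈⟨ x∙yz≈xz∙y _ _ _ ⟩
    (φ ((K.- K.1#) ^K toℕ j) A.* φ (DetK.det n (λ i k → C (punchIn j i) k))) A.* M j zero
      ≈⟨ A.*-congʳ (*-homo _ _) ⟨
    φ (CK.cofactor C j) A.* M j zero ∎
    where
    sign : Fin (suc n) → A.Carrier
    sign j = (A.- A.1#) ^A toℕ j

-- Linear combinations in a module and eigenvectors built from cofactors.

module Combinations (K : CommutativeRing c ℓ) (V : LeftModule (CommutativeRing.ring K) m ℓm) where
  open CommutativeRing K hiding (zero)
  open LeftModule V
  open CommutativeMonoidSum +ᴹ-commutativeMonoid using (∑-comm)
  open FiniteSums +ᴹ-commutativeMonoid using (∑-cong; sum-zero)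
  open SetoidReasoning ≈ᴹ-setoid

  Σᴷ : ∀ {n} → (Fin n → Carrier) → Carrier
  Σᴷ = sumᴹ +-rawMonoid

  Σⱽ : ∀ {n} → (Fin n → Carrierᴹ) → Carrierᴹ
  Σⱽ = sumᴹ +ᴹ-rawMonoid

  *ₗ-distribˡ-Σ : ∀ {n} r (f : Fin n → Carrierᴹ) → r *ₗ Σⱽ f ≈ᴹ Σⱽ (λ k → r *ₗ f k)
  *ₗ-distribˡ-Σ {zero}  r f = *ₗ-zeroʳ r
  *ₗ-distribˡ-Σ {suc n} r f = ≈ᴹ-trans (*ₗ-distribˡ _ _ _) (+ᴹ-congˡ (*ₗ-distribˡ-Σ r (f ∘ suc)))

  *ₗ-distribʳ-Σ : ∀ {n} (r : Fin n → Carrier) x → Σᴷ r *ₗ x ≈ᴹ Σⱽ (λ k → r k *ₗ x)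
  *ₗ-distribʳ-Σ {zero}  r x = *ₗ-zeroˡ x
  *ₗ-distribʳ-Σ {suc n} r x = ≈ᴹ-trans (*ₗ-distribʳ _ _ _) (+ᴹ-congˡ (*ₗ-distribʳ-Σ (r ∘ suc) x))

  Σ-substitute : ∀ {n n′} (q : Fin n → Carrier) (r : Fin n → Fin n′ → Carrier) (x : Fin n′ → Carrierᴹ) →
    Σⱽ (λ j → q j *ₗ Σⱽ (λ k → r j k *ₗ x k)) ≈ᴹ Σⱽ (λ k → Σᴷ (λ j → q j * r j k) *ₗ x k)
  Σ-substitute q r x = begin
    Σⱽ (λ j → q j *ₗ Σⱽ (λ k → r j k *ₗ x k))
      ≈⟨ ∑-cong (λ j → q j *ₗ Σⱽ (λ k → r j k *ₗ x k)) (λ j → Σⱽ (λ k → (q j * r j k) *ₗ x k))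
           (λ j → ≈ᴹ-trans (*ₗ-distribˡ-Σ (q j) (λ k → r j k *ₗ x k))
             (∑-cong (λ k → q j *ₗ r j k *ₗ x k) _ (λ k → ≈ᴹ-sym (*ₗ-assoc (q j) (r j k) (x k))))) ⟩
    Σⱽ (λ j → Σⱽ (λ k → (q j * r j k) *ₗ x k))
      ≈⟨ ∑-comm (λ j k → (q j * r j k) *ₗ x k) ⟩
    Σⱽ (λ k → Σⱽ (λ j → (q j * r j k) *ₗ x k))
      ≈⟨ ∑-cong (λ k → Σⱽ (λ j → (q j * r j k) *ₗ x k)) _
           (λ k → ≈ᴹ-sym (*ₗ-distribʳ-Σ (λ j → q j * r j k) (x k))) ⟩
    Σⱽ (λ k → Σᴷ (λ j → q j * r j k) *ₗ x k) ∎

  module _ {D : Carrierᴹ → Carrierᴹ}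
           (D-linear : ModuleMorphisms.LeftModuleMorphisms.IsLeftModuleHomomorphism rawLeftModule rawLeftModule D) where
    open ModuleMorphisms.LeftModuleMorphisms.IsLeftModuleHomomorphism D-linear
    open Cofactors K using (LowerTriangular; cofactor; cofactor-annihilates)

    Σ-homo : ∀ {n} (f : Fin n → Carrierᴹ) → D (Σⱽ f) ≈ᴹ Σⱽ (D ∘ f)
    Σ-homo {zero}  f = 0ᴹ-homo
    Σ-homo {suc n} f = ≈ᴹ-trans (+ᴹ-homo _ _) (+ᴹ-congˡ (Σ-homo (f ∘ suc)))

    -- The row vector of cofactors is a left null vector of `C`, so weighting the equations for
    -- `D (x j)` with it cancels every `s k` and leaves the multiple by `e`.
    cofactor-eigenvector : ∀ {n} (C : Fin (suc n) → Fin n → Carrier) → LowerTriangular C →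
      ∀ e (x : Fin (suc n) → Carrierᴹ) (s : Fin n → Carrierᴹ) →
      (∀ j → D (x j) ≈ᴹ e *ₗ x j +ᴹ Σⱽ (λ k → C j k *ₗ s k)) →
      D (Σⱽ (λ j → cofactor C j *ₗ x j)) ≈ᴹ e *ₗ Σⱽ (λ j → cofactor C j *ₗ x j)
    cofactor-eigenvector {n} C C-lower e x s Dx = begin
      D (Σⱽ (λ j → q j *ₗ x j))
        ≈⟨ Σ-homo (λ j → q j *ₗ x j) ⟩
      Σⱽ (λ j → D (q j *ₗ x j))
        ≈⟨ ∑-cong (λ j → D (q j *ₗ x j)) (λ j → e *ₗ q j *ₗ x j +ᴹ q j *ₗ y j) step ⟩
      Σⱽ (λ j → e *ₗ q j *ₗ x j +ᴹ q j *ₗ y j)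
        ≈⟨ ∑-distrib-+ (λ j → e *ₗ q j *ₗ x j) (λ j → q j *ₗ y j) ⟩
      Σⱽ (λ j → e *ₗ q j *ₗ x j) +ᴹ Σⱽ (λ j → q j *ₗ y j)
        ≈⟨ +ᴹ-cong (≈ᴹ-sym (*ₗ-distribˡ-Σ e (λ j → q j *ₗ x j))) vanish ⟩
      e *ₗ Σⱽ (λ j → q j *ₗ x j) +ᴹ 0ᴹ
        ≈⟨ +ᴹ-identityʳ _ ⟩
      e *ₗ Σⱽ (λ j → q j *ₗ x j) ∎
      where
      open CommutativeMonoidSum +ᴹ-commutativeMonoid using (∑-distrib-+)

      q : Fin (suc n) → Carrier
      q = cofactor C

      y : Fin (suc n) → Carrierᴹ
      y j = Σⱽ (λ k → C j k *ₗ s k)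

      step : ∀ j → D (q j *ₗ x j) ≈ᴹ e *ₗ q j *ₗ x j +ᴹ q j *ₗ y j
      step j = begin
        D (q j *ₗ x j)                      ≈⟨ *ₗ-homo _ _ ⟩
        q j *ₗ D (x j)                      ≈⟨ *ₗ-congˡ (Dx j) ⟩
        q j *ₗ (e *ₗ x j +ᴹ y j)            ≈⟨ *ₗ-distribˡ _ _ _ ⟩
        q j *ₗ e *ₗ x j +ᴹ q j *ₗ y j       ≈⟨ +ᴹ-congʳ (*ₗ-assoc _ _ _) ⟨
        (q j * e) *ₗ x j +ᴹ q j *ₗ y j      ≈⟨ +ᴹ-congʳ (*ₗ-congʳ (*-comm _ _)) ⟩
        (e * q j) *ₗ x j +ᴹ q j *ₗ y j      ≈⟨ +ᴹ-congʳ (*ₗ-assoc _ _ _) ⟩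
        e *ₗ q j *ₗ x j +ᴹ q j *ₗ y j       ∎

      vanish : Σⱽ (λ j → q j *ₗ y j) ≈ᴹ 0ᴹ
      vanish = ≈ᴹ-trans (Σ-substitute q C s)
        (sum-zero (λ k → Σᴷ (λ j → q j * C j k) *ₗ s k)
          (λ k → ≈ᴹ-trans (*ₗ-congʳ (cofactor-annihilates C C-lower k)) (*ₗ-zeroˡ _)))

-- Families that are unitriangular over a basis.

lookup-injective : (S : Setoid i ℓi) → ∀ {xs} → UniqueS.Unique S xs →
                   Injective _≡_ (Setoid._≈_ S) (List.lookup xs)
lookup-injective S (x∉ ∷ u) {zero}  {zero}  p = ≡.refl
lookup-injective S (x∉ ∷ u) {zero}  {suc j} p = contradiction p (All.lookup x∉ (Membershipₚ.∈-lookup j))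
lookup-injective S (x∉ ∷ u) {suc i} {zero}  p = contradiction (Setoid.sym S p) (All.lookup x∉ (Membershipₚ.∈-lookup i))
lookup-injective S (x∉ ∷ u) {suc i} {suc j} p = ≡.cong suc (lookup-injective S u p)

module UnitriangularFamilies
  (K : CommutativeRing c ℓ) (V : LeftModule (CommutativeRing.ring K) m ℓm) (I : DecSetoid i ℓi) where
  open CommutativeRing K hiding (zero)
  open LeftModule V
  open DecSetoid I using () renaming (Carrier to Index; _≈_ to _≈ᴵ_; _≟_ to _≟ᴵ_; setoid to setoidᴵ)
  open Basis _≈_ 0# rawLeftModule setoidᴵ
  open Combinations K V
  private
    module I = DecSetoid I
    module ΣK = FiniteSums +-commutativeMonoid
    module ΣV = FiniteSums +ᴹ-commutativeMonoid

  -- The indices may repeat, as in `IsBasis.spans`, so that two combinations are added by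
  -- concatenation.
  Span : (Index → Carrierᴹ) → Carrierᴹ → Set _
  Span x v = ∃[ n ] Σ[ at ∈ (Fin n → Index) ] Σ[ r ∈ (Fin n → Carrier) ] v ≈ᴹ combination x r at

  module _ (x : Index → Carrierᴹ) where
    span-resp : ∀ {v w} → w ≈ᴹ v → Span x v → Span x w
    span-resp w≈v (n , at , r , v≈) = n , at , r , ≈ᴹ-trans w≈v v≈

    span-generator : ∀ κ → Span x (x κ)
    span-generator κ = 1 , (λ _ → κ) , (λ _ → 1#) , ≈ᴹ-sym (≈ᴹ-trans (+ᴹ-identityʳ _) (*ₗ-identityˡ _))

    span-* : ∀ r {v} → Span x v → Span x (r *ₗ v)
    span-* r (n , at , q , v≈) = n , at , (λ k → r * q k) ,
      ≈ᴹ-trans (*ₗ-congˡ v≈) (≈ᴹ-trans (*ₗ-distribˡ-Σ r (λ k → q k *ₗ x (at k)))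
        (ΣV.∑-cong (λ k → r *ₗ q k *ₗ x (at k)) _ (λ k → ≈ᴹ-sym (*ₗ-assoc _ _ _))))

    span-combination-+ : ∀ {n} (r : Fin n → Carrier) (at : Fin n → Index) {w} →
                         Span x w → Span x (combination x r at +ᴹ w)
    span-combination-+ {zero}  r at w∈ = span-resp (+ᴹ-identityˡ _) w∈
    span-combination-+ {suc n} r at w∈
      with n′ , at′ , r′ , eq ← span-combination-+ (r ∘ suc) (at ∘ suc) w∈ =
      suc n′ , (at zero Vector.∷ at′) , (r zero Vector.∷ r′) , ≈ᴹ-trans (+ᴹ-assoc _ _ _) (+ᴹ-congˡ eq)

    span-+ : ∀ {v w} → Span x v → Span x w → Span x (v +ᴹ w)
    span-+ (n , at , r , v≈) w∈ = span-resp (+ᴹ-congʳ v≈) (span-combination-+ r at w∈)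

    span-Σ : ∀ {n} (f : Fin n → Carrierᴹ) → (∀ k → Span x (f k)) → Span x (Σⱽ f)
    span-Σ {zero}  f f∈ = 0 , (λ ()) , (λ ()) , ≈ᴹ-refl
    span-Σ {suc n} f f∈ = span-+ (f∈ zero) (span-Σ (f ∘ suc) (f∈ ∘ suc))

  Covers : ∀ {n ℓ′} → (Fin n → Index) → (Index → Set ℓ′) → Set _
  Covers at P = ∀ μ → P μ → ∃[ k ] at k ≈ᴵ μ

  record DownFinite {ℓ′} (_≼_ : Rel Index ℓ′) : Set (i ⊔ ℓi ⊔ ℓ′) where
    _≺_ : Rel Index _
    μ ≺ κ = μ ≼ κ × ¬ (μ ≈ᴵ κ)

    field
      ≼-refl         : ∀ {κ} → κ ≼ κ
      ≼-trans        : ∀ {κ μ ν} → κ ≼ μ → μ ≼ ν → κ ≼ ν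
      ≼-respˡ        : ∀ {κ μ ν} → μ ≈ᴵ ν → μ ≼ κ → ν ≼ κ
      _≼?_           : Decidable _≼_
      downSize       : Index → ℕ
      down           : ∀ κ → Fin (downSize κ) → Index
      down-≼         : ∀ κ k → down κ k ≼ κ
      down-covers    : ∀ κ → Covers (down κ) (_≼ κ)
      down-injective : ∀ κ → Injective _≡_ _≈ᴵ_ (down κ)

  module _ {ℓ′} {_≼_ : Rel Index ℓ′} (order : DownFinite _≼_) where
    open DownFinite order

    -- The family in `expand` may exceed the indices below `κ`, since `zero⋠` kills the surplus
    -- terms. This allows several `x κ` to be expanded over one family.
    record TriangularExpansion (x s : Index → Carrierᴹ) (t : Index → Index → Carrier) : Set (c ⊔ ℓ ⊔ ℓm ⊔ i ⊔ ℓi ⊔ ℓ′) where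
      field
        congʳ  : ∀ κ {μ ν} → μ ≈ᴵ ν → t κ μ ≈ t κ ν
        zero⋠  : ∀ {κ μ} → ¬ (μ ≼ κ) → t κ μ ≈ 0#
        expand : ∀ κ {n} (at : Fin n → Index) → Injective _≡_ _≈ᴵ_ at → Covers at (_≼ κ) →
                 x κ ≈ᴹ combination s (t κ ∘ at) at

    -- A family over which all `x (at j)` expand at once, so that a relation among them becomes one
    -- among the `s`. Duplicates are removed because `independent` asks for an injective family.
    jointCover : ∀ {n} (at : Fin n → Index) →
      ∃[ n′ ] Σ[ at′ ∈ (Fin n′ → Index) ] Injective _≡_ _≈ᴵ_ at′ × (∀ j → Covers at′ (_≼ at j))
    jointCover {n} at = _ , List.lookup family , lookup-injective setoidᴵ (UniqueDec.deduplicate-! I all) , covers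
      where
      all family : List Index
      all    = List.concatMap (List.tabulate ∘ down ∘ at) (List.allFin n)
      family = List.deduplicate _≟ᴵ_ all

      open MembershipS setoidᴵ using (_∈_)

      covers : ∀ j → Covers (List.lookup family) (_≼ at j)
      covers j μ μ≼ with k , dk≈μ ← down-covers (at j) μ μ≼ = Any.index ∈family , I.sym (AnyP.lookup-index ∈family)
        where
        ∈family : μ ∈ family
        ∈family = MembershipSP.∈-deduplicate⁺ setoidᴵ _≟ᴵ_ (λ p q → I.trans q (I.sym p))
          (AnyP.concatMap⁺ (List.tabulate ∘ down ∘ at)
            (Any.map (λ { ≡.refl → AnyP.tabulate⁺ k (I.sym dk≈μ) }) (Membershipₚ.∈-allFin j)))

    module _ {x s : Index → Carrierᴹ} {t : Index → Index → Carrier}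
             (triangular : TriangularExpansion x s t) (unit : ∀ κ → t κ κ ≈ 1#)
             (≺-wellFounded : WellFounded _≺_) where
      open TriangularExpansion triangular

      -- The expansion of `x κ` has coefficient one at `s κ`, so it can be solved for `s κ`; the
      -- other generators in it are strictly lower and covered by induction.
      generators-in-span : (∀ {κ μ} → κ ≈ᴵ μ → s κ ≈ᴹ s μ) → ∀ κ → Acc _≺_ κ → Span x (s κ)
      generators-in-span s-cong κ (acc rec) =
        extract (down κ) (down-≼ κ) (down-injective κ) (expand κ (down κ) (down-injective κ) (down-covers κ))
          (down-covers κ κ ≼-refl)
        where
        -- Generalised over the enumeration so that its length can be matched as `suc n`, which
        -- removing `k₀` with `punchIn` requires.
        extract : ∀ {n} (at : Fin n → Index) → (∀ k → at k ≼ κ) → Injective _≡_ _≈ᴵ_ at →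
                  x κ ≈ᴹ combination s (t κ ∘ at) at → ∃[ k ] at k ≈ᴵ κ → Span x (s κ)
        extract {suc n} at at-≼ at-injective xκ≈ (k₀ , k₀≈κ) =
          span-resp x solved (span-+ x (span-generator x κ) (span-* x (- 1#) (span-Σ x others others∈)))
          where
          f : Fin (suc n) → Carrierᴹ
          f k = t κ (at k) *ₗ s (at k)

          others : Fin n → Carrierᴹ
          others k = f (punchIn k₀ k)

          others∈ : ∀ k → Span x (others k)
          others∈ k = span-* x _ (generators-in-span s-cong _
            (rec (at-≼ _ , λ p → Fin.punchInᵢ≢i k₀ k (at-injective (I.trans p (I.sym k₀≈κ))))))

          xκ≈′ : x κ ≈ᴹ s κ +ᴹ Σⱽ others
          xκ≈′ = begin
            x κ                   ≈⟨ xκ≈ ⟩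
            Σⱽ f                  ≈⟨ sum-remove {i = k₀} f ⟩
            f k₀ +ᴹ Σⱽ others     ≈⟨ +ᴹ-congʳ (*ₗ-cong (trans (congʳ κ k₀≈κ) (unit κ)) (s-cong k₀≈κ)) ⟩
            1# *ₗ s κ +ᴹ Σⱽ others ≈⟨ +ᴹ-congʳ (*ₗ-identityˡ _) ⟩
            s κ +ᴹ Σⱽ others      ∎
            where
            open SetoidReasoning ≈ᴹ-setoid
            open CommutativeMonoidSum +ᴹ-commutativeMonoid using (sum-remove)

          solved : s κ ≈ᴹ x κ +ᴹ (- 1#) *ₗ Σⱽ others
          solved = begin
            s κ                                                ≈⟨ +ᴹ-identityʳ _ ⟨
            s κ +ᴹ 0ᴹ                                          ≈⟨ +ᴹ-congˡ (*ₗ-zeroˡ _) ⟨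
            s κ +ᴹ 0# *ₗ Σⱽ others                             ≈⟨ +ᴹ-congˡ (*ₗ-congʳ (-‿inverseʳ 1#)) ⟨
            s κ +ᴹ (1# - 1#) *ₗ Σⱽ others                      ≈⟨ +ᴹ-congˡ (*ₗ-distribʳ _ _ _) ⟩
            s κ +ᴹ (1# *ₗ Σⱽ others +ᴹ (- 1#) *ₗ Σⱽ others)    ≈⟨ +ᴹ-congˡ (+ᴹ-congʳ (*ₗ-identityˡ _)) ⟩
            s κ +ᴹ (Σⱽ others +ᴹ (- 1#) *ₗ Σⱽ others)          ≈⟨ +ᴹ-assoc _ _ _ ⟨
            (s κ +ᴹ Σⱽ others) +ᴹ (- 1#) *ₗ Σⱽ others          ≈⟨ +ᴹ-congʳ xκ≈′ ⟨
            x κ +ᴹ (- 1#) *ₗ Σⱽ others                         ∎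
            where open SetoidReasoning ≈ᴹ-setoid

      -- The coefficient of `s (at k)` in the relation is the sum of `r j * t (at j) (at k)`, hence
      -- zero. Terms with `at k` not below `at j` vanish by triangularity, and those strictly above
      -- `k` by induction from the maximal indices downwards; only `r k` is left.
      independence : IsBasis s → ∀ {n} (at : Fin n → Index) → Injective _≡_ _≈ᴵ_ at → ∀ r →
                     combination x r at ≈ᴹ 0ᴹ → ∀ k → r k ≈ 0#
      independence s-basis {n} at at-injective r Σrx≈0 k = vanish k (above-wellFounded k)
        where
        _⊏_ : Rel (Fin n) _
        j ⊏ k = at j ≺ at k

        -- `DownFinite` has no antisymmetry field; what transitivity of `⊏` requires of it comes
        -- from well-foundedness.
        ≺-asym : ∀ {μ κ} → μ ≺ κ → ¬ (κ ≺ μ)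
        ≺-asym = wf⇒asym ≺-wellFounded

        ⊏-trans : ∀ {j k l} → j ⊏ k → k ⊏ l → j ⊏ l
        ⊏-trans (j≼k , j≉k) (k≼l , k≉l) = ≼-trans j≼k k≼l , λ j≈l →
          ≺-asym (k≼l , k≉l) (≼-respˡ j≈l j≼k , λ l≈k → k≉l (I.sym l≈k))

        above-wellFounded : WellFounded (λ k j → j ⊏ k)
        above-wellFounded = Fin.spo-noetherian {_≈_ = _≡_} record
          { isEquivalence = ≡.isEquivalence
          ; irrefl        = λ { ≡.refl j⊏j → proj₂ j⊏j I.refl }
          ; trans         = ⊏-trans
          ; <-resp-≈      = (λ { ≡.refl p → p }) , (λ { ≡.refl p → p })
          }

        column : ∀ k → Σᴷ (λ j → r j * t (at j) (at k)) ≈ 0#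
        column k
          with n′ , at′ , inj′ , covers ← jointCover at
          with l , at′l≈ ← covers k (at k) ≼-refl = trans
            (ΣK.∑-cong (λ j → r j * t (at j) (at k)) (λ j → r j * t (at j) (at′ l))
              (λ j → *-congˡ (congʳ (at j) (I.sym at′l≈))))
            (IsBasis.independent s-basis at′ inj′ (λ l → Σᴷ (λ j → r j * t (at j) (at′ l))) (begin
              Σⱽ (λ l → Σᴷ (λ j → r j * t (at j) (at′ l)) *ₗ s (at′ l))
                ≈⟨ Σ-substitute r (λ j l → t (at j) (at′ l)) (s ∘ at′) ⟨
              Σⱽ (λ j → r j *ₗ Σⱽ (λ l → t (at j) (at′ l) *ₗ s (at′ l)))
                ≈⟨ ΣV.∑-cong (λ j → r j *ₗ x (at j)) _ (λ j → *ₗ-congˡ (expand (at j) at′ inj′ (covers j))) ⟨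
              Σⱽ (λ j → r j *ₗ x (at j))
                ≈⟨ Σrx≈0 ⟩
              0ᴹ ∎) l)
          where open SetoidReasoning ≈ᴹ-setoid

        vanish : ∀ k → Acc (λ k j → j ⊏ k) k → r k ≈ 0#
        vanish k (acc rec) = begin
          r k                                ≈⟨ *-identityʳ _ ⟨
          r k * 1#                           ≈⟨ *-congˡ (unit (at k)) ⟨
          r k * t (at k) (at k)              ≈⟨ ΣK.sum-single (λ j → r j * t (at j) (at k)) k others ⟨
          Σᴷ (λ j → r j * t (at j) (at k))   ≈⟨ column k ⟩
          0#                                 ∎
          where
          open SetoidReasoning setoid
          others : ∀ j → j ≢ k → r j * t (at j) (at k) ≈ 0#
          others j j≢k with at k ≼? at j
          ... | no  ⋠ = trans (*-congˡ (zero⋠ ⋠)) (zeroʳ _)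
          ... | yes ≼ = trans (*-congʳ (vanish j (rec (≼ , λ p → j≢k (at-injective (I.sym p)))))) (zeroˡ _)

      unitriangular-basis : (∀ {κ μ} → κ ≈ᴵ μ → s κ ≈ᴹ s μ) → IsBasis s → IsBasis x
      unitriangular-basis s-cong s-basis = record
        { independent = independence s-basis
        ; spans       = λ v → spanning v (IsBasis.spans s-basis v)
        }
        where
        spanning : ∀ v → Span s v → Span x v
        spanning v (n , at , r , v≈) = span-resp x v≈ (span-Σ x (λ k → r k *ₗ s (at k))
          (λ k → span-* x (r k) (generators-in-span s-cong (at k) (≺-wellFounded (at k)))))

    -- The eigenfunction attached to a linear extension.

    record LinearExtensionBelow (κ : Index) : Set (i ⊔ ℓi ⊔ ℓ′) where
      field
        size      : ℕ
        at        : Fin (suc size) → Index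
        at-≼      : ∀ k → at k ≼ κ
        covers    : Covers at (_≼ κ)
        injective : Injective _≡_ _≈ᴵ_ at
        last      : at (fromℕ size) ≈ᴵ κ
        refines   : ∀ j k → at j ≺ at k → j Fin.< k

      -- Injectivity would turn `at k ≼ at j` into a strict inequality, and `refines` would then put
      -- `k` before `j`.
      <⇒⋠ : ∀ {j k} → j Fin.< k → ¬ (at k ≼ at j)
      <⇒⋠ j<k k≼j = ℕ.<-asym j<k (refines _ _ (k≼j , λ k≈j → Fin.<⇒≢ j<k (≡.sym (injective k≈j))))

      covers-at : ∀ j → Covers at (_≼ at j)
      covers-at j μ μ≼ = covers μ (≼-trans μ≼ (at-≼ j))

    module HessenbergEigenfunction
      {D : Carrierᴹ → Carrierᴹ}
      (D-linear : ModuleMorphisms.LeftModuleMorphisms.IsLeftModuleHomomorphism rawLeftModule rawLeftModule D)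
      {x s : Index → Carrierᴹ} (x-cong : ∀ {κ μ} → κ ≈ᴵ μ → x κ ≈ᴹ x μ)
      {a b : Index → Index → Carrier} {ε : Index → Carrier} (ε-cong : ∀ {κ μ} → κ ≈ᴵ μ → ε κ ≈ ε μ)
      (a-triangular : TriangularExpansion x s a) (a-unit : ∀ κ → a κ κ ≈ 1#)
      (b-triangular : TriangularExpansion (D ∘ x) s b) (b-diagonal : ∀ κ → b κ κ ≈ ε κ)
      {κ : Index} (e : LinearExtensionBelow κ) where

      open ModuleMorphisms.LeftModuleMorphisms.IsLeftModuleHomomorphism D-linear
      open LinearExtensionBelow e
      open Cofactors K
      open RingProps ring using (-0#≈0#)
      open CommutativeMonoidSum +ᴹ-commutativeMonoid using (∑-distrib-+; sum-init-last)
      private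
        module a = TriangularExpansion a-triangular
        module b = TriangularExpansion b-triangular

      -- The matrix of D - ε κ from x ∘ at to s ∘ at.
      shifted : Fin (suc size) → Fin (suc size) → Carrier
      shifted j l = b (at j) (at l) - ε κ * a (at j) (at l)

      -- The last column, that of `s κ`, is left out because `shifted-last` shows it to be zero. In
      -- the Hessenberg matrix its place goes to the column of the `x (at j)`.
      C : Fin (suc size) → Fin size → Carrier
      C j k = shifted j (inject₁ k)

      shifted-upper : ∀ j l → j Fin.< l → shifted j l ≈ 0#
      shifted-upper j l j<l = begin
        b (at j) (at l) - ε κ * a (at j) (at l)   ≈⟨ +-cong (b.zero⋠ (<⇒⋠ j<l)) (-‿cong (*-congˡ (a.zero⋠ (<⇒⋠ j<l)))) ⟩
        0# - ε κ * 0#                             ≈⟨ +-identityˡ _ ⟩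
        - (ε κ * 0#)                              ≈⟨ -‿cong (zeroʳ _) ⟩
        - 0#                                      ≈⟨ -0#≈0# ⟩
        0#                                        ∎
        where open SetoidReasoning setoid

      shifted-diagonal : ∀ j → shifted j j ≈ ε (at j) - ε κ
      shifted-diagonal j = +-cong (b-diagonal _) (-‿cong (trans (*-congˡ (a-unit _)) (*-identityʳ _)))

      -- In the last row the shift cancels the diagonal entry, since `at` ends in `κ`; all other
      -- rows lie above the diagonal.
      shifted-last : ∀ j → shifted j (fromℕ size) ≈ 0#
      shifted-last j with j Fin.≟ fromℕ size
      ... | yes ≡.refl = trans (shifted-diagonal j) (trans (+-congʳ (ε-cong last)) (-‿inverseʳ _))
      ... | no  j≢last = shifted-upper j _ (Fin.≤∧≢⇒< (Fin.≤fromℕ j) j≢last)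

      C-lower : LowerTriangular C
      C-lower j k = shifted-upper j (inject₁ k)

      -- Both expansions are taken over the whole enumeration for `κ` rather than over the indices
      -- below `at j`, which makes the coefficients comparable index by index.
      D-expand : ∀ j → D (x (at j)) ≈ᴹ ε κ *ₗ x (at j) +ᴹ Σⱽ (λ k → C j k *ₗ s (at (inject₁ k)))
      D-expand j = begin
        D (x (at j))
          ≈⟨ b.expand (at j) at injective (covers-at j) ⟩
        Σⱽ (λ l → b (at j) (at l) *ₗ s (at l))
          ≈⟨ ΣV.∑-cong (λ l → b (at j) (at l) *ₗ s (at l)) _ split ⟩
        Σⱽ (λ l → ε κ *ₗ a (at j) (at l) *ₗ s (at l) +ᴹ shifted j l *ₗ s (at l))
          ≈⟨ ∑-distrib-+ (λ l → ε κ *ₗ a (at j) (at l) *ₗ s (at l)) (λ l → shifted j l *ₗ s (at l)) ⟩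
        Σⱽ (λ l → ε κ *ₗ a (at j) (at l) *ₗ s (at l)) +ᴹ Σⱽ (λ l → shifted j l *ₗ s (at l))
          ≈⟨ +ᴹ-cong (≈ᴹ-sym (*ₗ-distribˡ-Σ (ε κ) (λ l → a (at j) (at l) *ₗ s (at l))))
                     (sum-init-last (λ l → shifted j l *ₗ s (at l))) ⟩
        ε κ *ₗ Σⱽ (λ l → a (at j) (at l) *ₗ s (at l)) +ᴹ
          (Σⱽ (λ k → C j k *ₗ s (at (inject₁ k))) +ᴹ shifted j (fromℕ size) *ₗ s (at (fromℕ size)))
          ≈⟨ +ᴹ-cong (*ₗ-congˡ (≈ᴹ-sym (a.expand (at j) at injective (covers-at j))))
               (≈ᴹ-trans (+ᴹ-congˡ (≈ᴹ-trans (*ₗ-congʳ (shifted-last j)) (*ₗ-zeroˡ _))) (+ᴹ-identityʳ _)) ⟩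
        ε κ *ₗ x (at j) +ᴹ Σⱽ (λ k → C j k *ₗ s (at (inject₁ k))) ∎
        where
        open SetoidReasoning ≈ᴹ-setoid
        open GroupProps +-group using (//-rightDividesˡ)

        split : ∀ l → b (at j) (at l) *ₗ s (at l) ≈ᴹ ε κ *ₗ a (at j) (at l) *ₗ s (at l) +ᴹ shifted j l *ₗ s (at l)
        split l = begin
          b (at j) (at l) *ₗ s (at l)
            ≈⟨ *ₗ-congʳ (trans (sym (//-rightDividesˡ _ _)) (+-comm _ _)) ⟩
          (ε κ * a (at j) (at l) + shifted j l) *ₗ s (at l)
            ≈⟨ *ₗ-distribʳ _ _ _ ⟩
          (ε κ * a (at j) (at l)) *ₗ s (at l) +ᴹ shifted j l *ₗ s (at l)
            ≈⟨ +ᴹ-congʳ (*ₗ-assoc _ _ _) ⟩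
          ε κ *ₗ a (at j) (at l) *ₗ s (at l) +ᴹ shifted j l *ₗ s (at l) ∎

      -- `q` stands for the inverse of `ℰ`; asking only for the equation that defines it keeps the
      -- argument over a commutative ring.
      module _ (q : Carrier) (q-inverse : q * sumᴹ *-rawMonoid (λ k → ε κ - ε (at (inject₁ k))) ≈ 1#) where

        coefficients : Fin (suc size) → Carrier
        coefficients j = q * cofactor C j

        eigenfunction : Carrierᴹ
        eigenfunction = q *ₗ Σⱽ (λ j → cofactor C j *ₗ x (at j))

        eigen : D eigenfunction ≈ᴹ ε κ *ₗ eigenfunction
        eigen = begin
          D eigenfunction
            ≈⟨ *ₗ-homo _ _ ⟩
          q *ₗ D (Σⱽ (λ j → cofactor C j *ₗ x (at j)))
            ≈⟨ *ₗ-congˡ (cofactor-eigenvector D-linear C C-lower (ε κ) (x ∘ at) (λ k → s (at (inject₁ k))) D-expand) ⟩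
          q *ₗ ε κ *ₗ Σⱽ (λ j → cofactor C j *ₗ x (at j))
            ≈⟨ *ₗ-assoc _ _ _ ⟨
          (q * ε κ) *ₗ Σⱽ (λ j → cofactor C j *ₗ x (at j))
            ≈⟨ *ₗ-congʳ (*-comm _ _) ⟩
          (ε κ * q) *ₗ Σⱽ (λ j → cofactor C j *ₗ x (at j))
            ≈⟨ *ₗ-assoc _ _ _ ⟩
          ε κ *ₗ eigenfunction ∎
          where open SetoidReasoning ≈ᴹ-setoid

        eigenfunction-combination : eigenfunction ≈ᴹ combination x coefficients at
        eigenfunction-combination = ≈ᴹ-trans (*ₗ-distribˡ-Σ q (λ j → cofactor C j *ₗ x (at j)))
          (ΣV.∑-cong (λ j → q *ₗ cofactor C j *ₗ x (at j)) _ (λ j → ≈ᴹ-sym (*ₗ-assoc _ _ _)))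

        -- The signs in `cofactor-last` reverse the differences on the diagonal, which gives exactly
        -- the product that `q` inverts.
        coefficients-last : coefficients (fromℕ size) ≈ 1#
        coefficients-last = trans (*-congˡ (trans (cofactor-last C C-lower)
          (Π.∑-cong (λ k → - C (inject₁ k) k) _ negated))) q-inverse
          where
          module Π = FiniteSums *-commutativeMonoid
          open AbelianGroupProps +-abelianGroup using (⁻¹-anti-homo‿-)

          negated : ∀ k → - C (inject₁ k) k ≈ ε κ - ε (at (inject₁ k))
          negated k = trans (-‿cong (shifted-diagonal (inject₁ k))) (⁻¹-anti-homo‿- _ _)

        eigenfunction-monic : eigenfunction ≈ᴹ x κ +ᴹ combination x (coefficients ∘ inject₁) (at ∘ inject₁)
        eigenfunction-monic = begin
          eigenfunction
            ≈⟨ eigenfunction-combination ⟩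
          combination x coefficients at
            ≈⟨ sum-init-last (λ j → coefficients j *ₗ x (at j)) ⟩
          combination x (coefficients ∘ inject₁) (at ∘ inject₁) +ᴹ coefficients (fromℕ size) *ₗ x (at (fromℕ size))
            ≈⟨ +ᴹ-comm _ _ ⟩
          coefficients (fromℕ size) *ₗ x (at (fromℕ size)) +ᴹ combination x (coefficients ∘ inject₁) (at ∘ inject₁)
            ≈⟨ +ᴹ-congʳ (≈ᴹ-trans (*ₗ-cong coefficients-last (x-cong last)) (*ₗ-identityˡ _)) ⟩
          x κ +ᴹ combination x (coefficients ∘ inject₁) (at ∘ inject₁) ∎
          where open SetoidReasoning ≈ᴹ-setoid

        -- The coordinates of `eigenfunction` with respect to `s`, obtained by composing its
        -- coefficients in `x` with the transition matrix `a`.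
        t : Index → Carrier
        t μ = Σᴷ (λ j → coefficients j * a (at j) μ)

        t-congʳ : ∀ {μ ν} → μ ≈ᴵ ν → t μ ≈ t ν
        t-congʳ μ≈ν = ΣK.∑-cong (λ j → coefficients j * a (at j) _) _ (λ j → *-congˡ (a.congʳ (at j) μ≈ν))

        t-zero : ∀ {μ} → ¬ (μ ≼ κ) → t μ ≈ 0#
        t-zero μ⋠ = ΣK.sum-zero (λ j → coefficients j * a (at j) _)
          (λ j → trans (*-congˡ (a.zero⋠ λ μ≼ → μ⋠ (≼-trans μ≼ (at-≼ j)))) (zeroʳ _))

        -- Only the last summand survives, because `κ` is below no earlier `at j`.
        t-unit : t κ ≈ 1#
        t-unit = begin
          Σᴷ (λ j → coefficients j * a (at j) κ)
            ≈⟨ ΣK.sum-single (λ j → coefficients j * a (at j) κ) (fromℕ size) others ⟩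
          coefficients (fromℕ size) * a (at (fromℕ size)) κ
            ≈⟨ *-cong coefficients-last (trans (a.congʳ _ (I.sym last)) (a-unit _)) ⟩
          1# * 1#
            ≈⟨ *-identityˡ _ ⟩
          1# ∎
          where
          open SetoidReasoning setoid
          others : ∀ j → j ≢ fromℕ size → coefficients j * a (at j) κ ≈ 0#
          others j j≢last = trans (*-congˡ (a.zero⋠ λ κ≼ →
            <⇒⋠ (Fin.≤∧≢⇒< (Fin.≤fromℕ j) j≢last) (≼-respˡ (I.sym last) κ≼))) (zeroʳ _)

        t-expand : ∀ {n} (at′ : Fin n → Index) → Injective _≡_ _≈ᴵ_ at′ → Covers at′ (_≼ κ) →
                   eigenfunction ≈ᴹ combination s (t ∘ at′) at′
        t-expand at′ injective′ covers′ = begin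
          eigenfunction
            ≈⟨ eigenfunction-combination ⟩
          Σⱽ (λ j → coefficients j *ₗ x (at j))
            ≈⟨ ΣV.∑-cong (λ j → coefficients j *ₗ x (at j)) _
                 (λ j → *ₗ-congˡ (a.expand (at j) at′ injective′ (λ μ μ≼ → covers′ μ (≼-trans μ≼ (at-≼ j))))) ⟩
          Σⱽ (λ j → coefficients j *ₗ Σⱽ (λ l → a (at j) (at′ l) *ₗ s (at′ l)))
            ≈⟨ Σ-substitute coefficients (λ j l → a (at j) (at′ l)) (s ∘ at′) ⟩
          Σⱽ (λ l → t (at′ l) *ₗ s (at′ l)) ∎
          where open SetoidReasoning ≈ᴹ-setoid

-- The ring and module structure of the Weyl invariants.

module InvariantAlgebra {ℝ : RealNumbers c ℓ₁ ℓ₂} {E : EuclideanSpace ℝ m ℓm} {R : RootSystem E} (R⁺ : PositiveSystem R) where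
  open RealNumbers ℝ
  open WeylInvariants R⁺ hiding (_,_)
  open Weights R
  open GroupAlgebra commutativeRing weightGroup _≟ᵂ_
  open SetoidReasoning setoid
  private
    module G = AbelianGroup weightGroup

  ⊕-comm : ∀ f g → f ⊕ g ≋ g ⊕ f
  ⊕-comm f g μ = trans (evaluate-⊕ (δ μ) f g) (trans (+-comm _ _) (sym (evaluate-⊕ (δ μ) g f)))

  ⊕-assoc : ∀ f g h → (f ⊕ g) ⊕ h ≋ f ⊕ (g ⊕ h)
  ⊕-assoc f g h μ = reflexive (≡.cong (coefficient μ) (List.++-assoc f g h))

  ⊖-inverseʳ : ∀ f → f ⊕ ⊖ f ≋ []
  ⊖-inverseʳ f μ = trans (evaluate-⊕ (δ μ) f (⊖ f)) (trans (+-congˡ (evaluate-⊖ (δ μ) f)) (-‿inverseʳ _))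

  ⊛-assoc : ∀ f g h → (f ⊛ g) ⊛ h ≋ f ⊛ (g ⊛ h)
  ⊛-assoc f g h μ = begin
    coefficient μ ((f ⊛ g) ⊛ h)
      ≈⟨ evaluate-⊛ (δ μ) (f ⊛ g) h ⟩
    evaluate (λ x → evaluate (λ z → δ μ (x G.∙ z)) h) (f ⊛ g)
      ≈⟨ evaluate-⊛ (λ x → evaluate (λ z → δ μ (x G.∙ z)) h) f g ⟩
    evaluate (λ x → evaluate (λ y → evaluate (λ z → δ μ ((x G.∙ y) G.∙ z)) h) g) f
      ≈⟨ evaluate-cong (λ x → evaluate-cong (λ y → evaluate-cong (λ z →
           δ-congˡ {μ} {(x G.∙ y) G.∙ z} {x G.∙ (y G.∙ z)} (G.assoc x y z)) h) g) f ⟩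
    evaluate (λ x → evaluate (λ y → evaluate (λ z → δ μ (x G.∙ (y G.∙ z))) h) g) f
      ≈⟨ evaluate-cong (λ x → evaluate-⊛ (λ y → δ μ (x G.∙ y)) g h) f ⟨
    evaluate (λ x → evaluate (λ y → δ μ (x G.∙ y)) (g ⊛ h)) f
      ≈⟨ evaluate-⊛ (δ μ) f (g ⊛ h) ⟨
    coefficient μ (f ⊛ (g ⊛ h)) ∎

  ⊛-distribʳ-⊕ : ∀ f g h → (g ⊕ h) ⊛ f ≋ (g ⊛ f) ⊕ (h ⊛ f)
  ⊛-distribʳ-⊕ f g h μ = begin
    coefficient μ ((g ⊕ h) ⊛ f)       ≈⟨ evaluate-⊛ (δ μ) (g ⊕ h) f ⟩
    evaluate φ (g ⊕ h)                ≈⟨ evaluate-⊕ φ g h ⟩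
    evaluate φ g + evaluate φ h       ≈⟨ +-cong (evaluate-⊛ (δ μ) g f) (evaluate-⊛ (δ μ) h f) ⟨
    coefficient μ (g ⊛ f) + coefficient μ (h ⊛ f) ≈⟨ evaluate-⊕ (δ μ) (g ⊛ f) (h ⊛ f) ⟨
    coefficient μ ((g ⊛ f) ⊕ (h ⊛ f)) ∎
    where
    φ : G.Carrier → Carrier
    φ x = evaluate (λ y → δ μ (x G.∙ y)) f

  ⊛-distribˡ-⊕ : ∀ f g h → f ⊛ (g ⊕ h) ≋ (f ⊛ g) ⊕ (f ⊛ h)
  ⊛-distribˡ-⊕ f g h μ = begin
    coefficient μ (f ⊛ (g ⊕ h))                     ≈⟨ ⊛-comm f (g ⊕ h) μ ⟩
    coefficient μ ((g ⊕ h) ⊛ f)                     ≈⟨ ⊛-distribʳ-⊕ f g h μ ⟩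
    coefficient μ ((g ⊛ f) ⊕ (h ⊛ f))               ≈⟨ ⊕-cong {g ⊛ f} {f ⊛ g} {h ⊛ f} {f ⊛ h} (⊛-comm g f) (⊛-comm h f) μ ⟩
    coefficient μ ((f ⊛ g) ⊕ (f ⊛ h))               ∎

  -- The bridge between the ring, in which the determinant is formed, and the module, in which `D`
  -- is linear.
  constant-⊛ : ∀ r f → constant r ⊛ f ≋ r ⊙ f
  constant-⊛ r f μ = begin
    coefficient μ (constant r ⊛ f)                       ≈⟨ evaluate-⊛ (δ μ) (constant r) f ⟩
    r * evaluate (λ y → δ μ (G.ε G.∙ y)) f + 0#          ≈⟨ +-identityʳ _ ⟩
    r * evaluate (λ y → δ μ (G.ε G.∙ y)) f               ≈⟨ *-congˡ (evaluate-cong (λ y → δ-congˡ {μ} {G.ε G.∙ y} {y} (G.identityˡ y)) f) ⟩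
    r * coefficient μ f                                  ≈⟨ evaluate-⊙ (δ μ) r f ⟨
    coefficient μ (r ⊙ f)                                ∎

  ⊙-identityˡ : ∀ f → 1# ⊙ f ≋ f
  ⊙-identityˡ f μ = trans (evaluate-⊙ (δ μ) 1# f) (*-identityˡ _)

  1⊛ : ∀ f → constant 1# ⊛ f ≋ f
  1⊛ f μ = trans (constant-⊛ 1# f μ) (⊙-identityˡ f μ)

  +ᴬ-isAbelianGroup : IsAbelianGroup _≈ᴬ_ _+ᴬ_ 0ᴬ -ᴬ_
  +ᴬ-isAbelianGroup = record
    { isGroup = record
      { isMonoid = record
        { isSemigroup = record
          { isMagma = record
            { isEquivalence = record
              { refl  = λ _ → refl
              ; sym   = λ p μ → sym (p μ)
              ; trans = λ p q μ → trans (p μ) (q μ)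
              }
            ; ∙-cong = λ {f} {f′} {g} {g′} → ⊕-cong {element f} {element f′} {element g} {element g′}
            }
          ; assoc = λ f g h → ⊕-assoc (element f) (element g) (element h)
          }
        ; identity = (λ f μ → refl) , (λ f μ → reflexive (≡.cong (coefficient μ) (List.++-identityʳ (element f))))
        }
      ; inverse = (λ f μ → trans (⊕-comm (⊖ element f) (element f) μ) (⊖-inverseʳ (element f) μ))
                , (λ f → ⊖-inverseʳ (element f))
      ; ⁻¹-cong = λ {f} {g} → ⊖-cong {element f} {element g}
      }
    ; comm = λ f g → ⊕-comm (element f) (element g)
    }

  𝒜ᵂ-commutativeRing : CommutativeRing _ _
  𝒜ᵂ-commutativeRing = record
    { _≈_ = _≈ᴬ_ ; _+_ = _+ᴬ_ ; _*_ = _*ᴬ_ ; -_ = -ᴬ_ ; 0# = 0ᴬ ; 1# = constantᴬ 1#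
    ; isCommutativeRing = record
      { isRing = record
        { +-isAbelianGroup = +ᴬ-isAbelianGroup
        ; *-cong     = λ {f} {f′} {g} {g′} → ⊛-cong {element f} {element f′} {element g} {element g′}
        ; *-assoc    = λ f g h → ⊛-assoc (element f) (element g) (element h)
        ; *-identity = (λ f → 1⊛ (element f))
                     , (λ f μ → trans (⊛-comm (element f) (constant 1#) μ) (1⊛ (element f) μ))
        ; distrib    = (λ f g h → ⊛-distribˡ-⊕ (element f) (element g) (element h))
                     , (λ f g h → ⊛-distribʳ-⊕ (element f) (element g) (element h))
        }
      ; *-comm = λ f g → ⊛-comm (element f) (element g)
      }
    }

  𝒜ᵂ-leftModule : LeftModule ring _ _
  𝒜ᵂ-leftModule = record
    { _≈ᴹ_ = _≈ᴬ_ ; _+ᴹ_ = _+ᴬ_ ; _*ₗ_ = _∙ᴬ_ ; 0ᴹ = 0ᴬ ; -ᴹ_ = -ᴬ_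
    ; isLeftModule = record
      { isLeftSemimodule = record
        { +ᴹ-isCommutativeMonoid = IsAbelianGroup.isCommutativeMonoid +ᴬ-isAbelianGroup
        ; isPreleftSemimodule = record
          { *ₗ-cong      = λ {r} {r′} {f} {g} p q μ → trans (evaluate-⊙ (δ μ) r (element f))
                             (trans (*-cong p (q μ)) (sym (evaluate-⊙ (δ μ) r′ (element g))))
          ; *ₗ-zeroˡ     = λ f μ → trans (evaluate-⊙ (δ μ) 0# (element f)) (zeroˡ _)
          ; *ₗ-distribʳ  = λ f r r′ μ → trans (evaluate-⊙ (δ μ) (r + r′) (element f)) (trans (distribʳ _ _ _)
                             (sym (trans (evaluate-⊕ (δ μ) (r ⊙ element f) (r′ ⊙ element f))
                               (+-cong (evaluate-⊙ (δ μ) r (element f)) (evaluate-⊙ (δ μ) r′ (element f))))))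
          ; *ₗ-identityˡ = λ f → ⊙-identityˡ (element f)
          ; *ₗ-assoc     = λ r r′ f μ → trans (evaluate-⊙ (δ μ) (r * r′) (element f)) (trans (*-assoc _ _ _)
                             (sym (trans (evaluate-⊙ (δ μ) r (r′ ⊙ element f)) (*-congˡ (evaluate-⊙ (δ μ) r′ (element f))))))
          ; *ₗ-zeroʳ     = λ r μ → refl
          ; *ₗ-distribˡ  = λ r f g μ → reflexive (≡.cong (coefficient μ)
                             (List.map-++ (λ (s , x) → r * s , x) (element f) (element g)))
          }
        }
      ; -ᴹ‿cong    = λ {f} {g} → ⊖-cong {element f} {element g}
      ; -ᴹ‿inverse = IsAbelianGroup.inverse +ᴬ-isAbelianGroup
      }
    }

  constantᴬ-cong : ∀ {r r′} → r ≈ r′ → constantᴬ r ≈ᴬ constantᴬ r′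
  constantᴬ-cong p μ = +-congʳ (*-congʳ p)

  constantᴬ-homo : RingMorphisms.IsRingHomomorphism rawRing 𝒜ᵂ constantᴬ
  constantᴬ-homo = record
    { isSemiringHomomorphism = record
      { isNearSemiringHomomorphism = record
        { +-isMonoidHomomorphism = record
          { isMagmaHomomorphism = record
            { isRelHomomorphism = record { cong = constantᴬ-cong }
            ; homo = λ r r′ μ → trans (+-identityʳ _) (trans (distribʳ _ _ _) (+-congˡ (sym (+-identityʳ _))))
            }
          ; ε-homo = λ μ → trans (+-identityʳ _) (zeroˡ _)
          }
        ; *-homo = λ r r′ μ → sym (constant-⊛ r (constant r′) μ)
        }
      ; 1#-homo = λ μ → refl
      }
    ; -‿homo = λ r μ → refl
    }

  ∈-orbit-resp : ∀ {κ κ′ μ} → κ ≈ᵂ κ′ → MembershipS._∈_ G.setoid μ (orbit κ) → MembershipS._∈_ G.setoid μ (orbit κ′)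
  ∈-orbit-resp {κ} {κ′} {μ} κ≈κ′ μ∈ with w , p ← ∈-orbit⁻ {κ} {μ} μ∈ =
    ∈-orbit⁺ {κ′} {μ} w (EuclideanSpace.≈ᴹ-trans E p (act-cong w κ≈κ′))

  -- Equal weights may yield different lists of orbit elements, so coefficients are compared: each
  -- is one or zero according to membership, which does not depend on the representative.
  orbitSum-cong : ∀ {κ κ′} → κ ≈ᵂ κ′ → orbitSum κ ≈ᴬ orbitSum κ′
  orbitSum-cong {κ} {κ′} κ≈κ′ μ with DecMembershipS._∈?_ weightDecSetoid μ (orbit κ)
  ... | yes μ∈ = trans (evaluate-unique-∈ {μ} (orbit-unique κ) μ∈)
                       (sym (evaluate-unique-∈ {μ} (orbit-unique κ′) (∈-orbit-resp {κ} {κ′} {μ} κ≈κ′ μ∈)))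
  ... | no μ∉  = trans (evaluate-unique-∉ {μ} μ∉)
                       (sym (evaluate-unique-∉ {μ} (μ∉ ∘ ∈-orbit-resp {κ′} {κ} {μ} (EuclideanSpace.≈ᴹ-sym E κ≈κ′))))

-- The order on dominant weights.

module DominanceOrder {ℝ : RealNumbers c ℓ₁ ℓ₂} {E : EuclideanSpace ℝ m ℓm} {R : RootSystem E} (R⁺ : PositiveSystem R) where
  open RealNumbers ℝ using (Carrier; commutativeRing; _≈_; 0#)
  open EuclideanSpace E
  open RootSystem R using (∣R∣; root)
  open PositiveSystem R⁺ using (Positive)
  open Weights R using (_≟ᵂ_; vector)
  open WeylInvariants R⁺ hiding (_,_)
  open InvariantAlgebra R⁺
  open CommutativeMonoidSum +ᴹ-commutativeMonoid using (∑-distrib-+)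
  open FiniteSums +ᴹ-commutativeMonoid using (∑-cong; sum-zero)
  open SetoidReasoning ≈ᴹ-setoid

  𝒫⁺-decSetoid : DecSetoid _ _
  𝒫⁺-decSetoid = record
    { isDecEquivalence = record
      { isEquivalence = Setoid.isEquivalence 𝒫⁺
      ; _≟_           = λ μ ν → toWeight μ ≟ᵂ toWeight ν
      }
    }

  open UnitriangularFamilies commutativeRing 𝒜ᵂ-leftModule 𝒫⁺-decSetoid public

  𝒬⁺-resp : ∀ {x y} → x ≈ᴹ y → 𝒬⁺ x → 𝒬⁺ y
  𝒬⁺-resp x≈y (n , positive , x≈) = n , positive , ≈ᴹ-trans (≈ᴹ-sym x≈y) x≈

  𝒬⁺-0 : 𝒬⁺ 0ᴹ
  𝒬⁺-0 = (λ _ → 0) , (λ i 0≢0 → contradiction ≡.refl 0≢0) , ≈ᴹ-sym (sum-zero {∣R∣} (λ _ → 0ᴹ) (λ _ → ≈ᴹ-refl))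

  𝒬⁺-+ : ∀ {x y} → 𝒬⁺ x → 𝒬⁺ y → 𝒬⁺ (x +ᴹ y)
  𝒬⁺-+ {x} {y} (n , n-positive , x≈) (n′ , n′-positive , y≈) =
    (λ i → n i ℕ.+ n′ i) , positive , (begin
      x +ᴹ y                                                          ≈⟨ +ᴹ-cong x≈ y≈ ⟩
      sumᴹ +ᴹ-rawMonoid (λ i → n i ×ᴹ root i) +ᴹ sumᴹ +ᴹ-rawMonoid (λ i → n′ i ×ᴹ root i)
        ≈⟨ ∑-distrib-+ (λ i → n i ×ᴹ root i) (λ i → n′ i ×ᴹ root i) ⟨
      sumᴹ +ᴹ-rawMonoid (λ i → n i ×ᴹ root i +ᴹ n′ i ×ᴹ root i)
        ≈⟨ ∑-cong _ (λ i → n i ×ᴹ root i +ᴹ n′ i ×ᴹ root i) (λ i → ×-homo-+ (root i) (n i) (n′ i)) ⟨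
      sumᴹ +ᴹ-rawMonoid (λ i → (n i ℕ.+ n′ i) ×ᴹ root i)               ∎)
    where
    open MonoidMult +ᴹ-monoid using (×-homo-+) renaming (_×_ to _×ᴹ_)
    positive : ∀ i → n i ℕ.+ n′ i ≢ 0 → Positive i
    positive i n+n′≢0 with n i ℕ.≟ 0
    ... | no  n≢0 = n-positive i n≢0
    ... | yes n≡0 = n′-positive i λ n′≡0 → n+n′≢0 (≡.cong₂ ℕ._+_ n≡0 n′≡0)

  ≼-refl : ∀ {κ} → κ ≼ κ
  ≼-refl = 𝒬⁺-resp (≈ᴹ-sym (-ᴹ‿inverseʳ _)) 𝒬⁺-0

  ≼-trans : ∀ {κ μ ν} → κ ≼ μ → μ ≼ ν → κ ≼ ν
  ≼-trans {κ} {μ} {ν} κ≼μ μ≼ν = 𝒬⁺-resp (begin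
    (ν′ -ᴹ μ′) +ᴹ (μ′ -ᴹ κ′)   ≈⟨ +ᴹ-assoc _ _ _ ⟨
    ((ν′ -ᴹ μ′) +ᴹ μ′) -ᴹ κ′   ≈⟨ +ᴹ-congʳ (//-rightDividesˡ μ′ ν′) ⟩
    ν′ -ᴹ κ′                   ∎) (𝒬⁺-+ μ≼ν κ≼μ)
    where
    open GroupProps +ᴹ-group using (//-rightDividesˡ)
    κ′ = vector (toWeight κ)
    μ′ = vector (toWeight μ)
    ν′ = vector (toWeight ν)

  ≼-respˡ : ∀ {κ μ ν} → μ ≈ᴾ ν → μ ≼ κ → ν ≼ κ
  ≼-respˡ μ≈ν = 𝒬⁺-resp (+ᴹ-congˡ (-ᴹ‿cong μ≈ν))

  -- Every expansion comes with an enumeration of the weights below κ, for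
  -- each κ; this is what makes _≼_ decidable.
  module _ {x s : DominantWeight → Invariant} {r : DominantWeight → DominantWeight → Carrier}
           (expansion : Expansion x s r) where
    open Expansion expansion
    private
      module Down κ = Enumerates (proj₁ (proj₂ (proj₂ (expands κ))))

    expansion⇒downFinite : DownFinite _≼_
    expansion⇒downFinite = record
      { ≼-refl         = λ {κ} → ≼-refl {κ}
      ; ≼-trans        = λ {κ} {μ} {ν} → ≼-trans {κ} {μ} {ν}
      ; ≼-respˡ        = λ {κ} {μ} {ν} → ≼-respˡ {κ} {μ} {ν}
      ; _≼?_           = _≼?_
      ; downSize       = λ κ → proj₁ (expands κ)
      ; down           = down
      ; down-≼         = Down.below
      ; down-covers    = Down.complete
      ; down-injective = λ κ → Down.injective κ
      }
      where
      down : ∀ κ → Fin (proj₁ (expands κ)) → DominantWeight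
      down κ = proj₁ (proj₂ (expands κ))

      _≼?_ : Decidable _≼_
      μ ≼? κ with Fin.any? (λ k → toWeight (down κ k) ≟ᵂ toWeight μ)
      ... | yes (k , p) = yes (≼-respˡ {κ} {down κ k} {μ} p (Down.below κ k))
      ... | no  ∄k      = no (∄k ∘ Down.complete κ μ)

    module _ (s-cong : ∀ {κ μ} → κ ≈ᴾ μ → s κ ≈ᴬ s μ) (order : DownFinite _≼_) where
      -- The sum over the enumeration supplied with `κ` is carried to the given family by
      -- `sum-reindex`. An index of that family missed by the enumeration is not below `κ`, so
      -- `r-zero` removes its term.
      expansion⇒triangular : TriangularExpansion order x s r
      expansion⇒triangular = record
        { congʳ  = λ κ μ≈ν → r-cong ≈ᴹ-refl μ≈ν
        ; zero⋠  = λ {κ} {μ} → r-zero κ μ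
        ; expand = expand
        }
        where
        open FiniteSums (LeftModule.+ᴹ-commutativeMonoid 𝒜ᵂ-leftModule) using (sum-reindex)
        module 𝒜 = LeftModule 𝒜ᵂ-leftModule

        expand : ∀ κ {n} (at : Fin n → DominantWeight) → Injective _≡_ _≈ᴾ_ at → Covers at (_≼ κ) →
                 x κ ≈ᴬ combination s (r κ ∘ at) at
        expand κ at injective covers with n , at₀ , enumerates , xκ≈ ← expands κ =
          𝒜.≈ᴹ-trans {x κ} {combination s (r κ ∘ at₀) at₀} {combination s (r κ ∘ at) at} xκ≈
            (sum-reindex 𝒫⁺ (λ μ → r κ μ ∙ᴬ s μ)
              (λ {μ} {ν} μ≈ν → 𝒜.*ₗ-cong {r κ μ} {r κ ν} {s μ} {s ν} (r-cong ≈ᴹ-refl μ≈ν) (s-cong μ≈ν))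
              at₀ at (Enumerates.injective enumerates) injective
              (λ k → covers (at₀ k) (Enumerates.below enumerates k)) missed)
          where
          missed : ∀ k → (∀ i → ¬ at₀ i ≈ᴾ at k) → r κ (at k) ∙ᴬ s (at k) ≈ᴬ 0ᴬ
          missed k ∉at₀ = 𝒜.≈ᴹ-trans {r κ (at k) ∙ᴬ s (at k)} {0# ∙ᴬ s (at k)} {0ᴬ}
            (𝒜.*ₗ-congʳ {s (at k)} (r-zero κ (at k) λ ≼κ →
              let i , p = Enumerates.complete enumerates (at k) ≼κ in ∉at₀ i p))
            (𝒜.*ₗ-zeroˡ (s (at k)))

  module _ (order : DownFinite _≼_) where
    linearExtensionBelow : ∀ {κ} → LinearExtension κ → LinearExtensionBelow order κ
    linearExtensionBelow e = record
      { size      = n-1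
      ; at        = at
      ; at-≼      = Enumerates.below enumerates
      ; covers    = Enumerates.complete enumerates
      ; injective = Enumerates.injective enumerates
      ; last      = last
      ; refines   = refines
      }
      where open LinearExtension e

  -- Everything below `κ` occurs in its linear extension, where by `refines` a descent in `≺` lowers
  -- the position; so `≺` inherits accessibility from `<` on positions.
  ≺-wellFounded : (∀ κ → LinearExtension κ) → WellFounded _≺_
  ≺-wellFounded e κ = Acc-resp-flip-≈ (λ {ν} {μ} {μ′} → ≺-respʳ {ν} {μ} {μ′}) last
    (accessible (fromℕ n-1) (Fin.<-wellFounded _))
    where
    open LinearExtension (e κ)

    ≺-respʳ : ∀ {ν μ μ′} → μ′ ≈ᴾ μ → ν ≺ μ → ν ≺ μ′
    ≺-respʳ μ′≈μ (ν≼μ , ν≉μ) = 𝒬⁺-resp (+ᴹ-congʳ (≈ᴹ-sym μ′≈μ)) ν≼μ , λ ν≈μ′ → ν≉μ (≈ᴹ-trans ν≈μ′ μ′≈μ)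

    accessible : ∀ k → Acc Fin._<_ k → Acc _≺_ (at k)
    accessible k (acc rec) = acc λ {μ} (μ≼ , μ≉) →
      let j , atj≈μ = Enumerates.complete enumerates μ
                        (≼-trans {μ} {at k} {κ} μ≼ (Enumerates.below enumerates k)) in
      Acc-resp-flip-≈ (λ {ν} {μ} {μ′} → ≺-respʳ {ν} {μ} {μ′}) atj≈μ
        (accessible j (rec (refines j k
          (≼-respˡ {at k} {μ} {at j} (≈ᴹ-sym atj≈μ) μ≼ , λ p → μ≉ (≈ᴹ-trans (≈ᴹ-sym atj≈μ) p)))))

-- Nonzero products of real numbers.

module RealField (ℝ : RealNumbers c ℓ₁ ℓ₂) where
  open RealNumbers ℝ
  open SetoidReasoning setoid

  1≉0 : ¬ (1# ≈ 0#)
  1≉0 1≈0 = IsStrictTotalOrder.irrefl isStrictTotalOrder (sym 1≈0) 0<1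

  *-nonzero : ∀ {x y} → ¬ (x ≈ 0#) → ¬ (y ≈ 0#) → ¬ (x * y ≈ 0#)
  *-nonzero {x} {y} x≉0 y≉0 xy≈0 = y≉0 (begin
    y                ≈⟨ *-identityˡ y ⟨
    1# * y           ≈⟨ *-congʳ (⁻¹-inverseʳ x≉0) ⟨
    (x * x ⁻¹) * y   ≈⟨ *-congʳ (*-comm _ _) ⟩
    (x ⁻¹ * x) * y   ≈⟨ *-assoc _ _ _ ⟩
    x ⁻¹ * (x * y)   ≈⟨ *-congˡ xy≈0 ⟩
    x ⁻¹ * 0#        ≈⟨ zeroʳ _ ⟩
    0#               ∎)

  product-nonzero : ∀ {n} (f : Fin n → Carrier) → (∀ k → ¬ (f k ≈ 0#)) → ¬ (sumᴹ *-rawMonoid f ≈ 0#)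
  product-nonzero {zero}  f f≉0 = 1≉0
  product-nonzero {suc n} f f≉0 = *-nonzero (f≉0 zero) (product-nonzero (f ∘ suc) (f≉0 ∘ suc))

-- The determinantal eigenfunctions of `D`.

module WeylEigenfunctions
  {ℝ : RealNumbers c ℓ₁ ℓ₂} {E : EuclideanSpace ℝ m ℓm} {R : RootSystem E} (R⁺ : PositiveSystem R)
  (D : WeylInvariants.Invariant R⁺ → WeylInvariants.Invariant R⁺) (D-linear : WeylInvariants.IsLinear R⁺ D)
  (s : WeylInvariants.DominantWeight R⁺ → WeylInvariants.Invariant R⁺)
  (s-cong : ∀ {κ κ′} → WeylInvariants._≈ᴾ_ R⁺ κ κ′ → WeylInvariants._≈ᴬ_ R⁺ (s κ) (s κ′))
  (a b : WeylInvariants.DominantWeight R⁺ → WeylInvariants.DominantWeight R⁺ → RealNumbers.Carrier ℝ)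
  (ε : WeylInvariants.DominantWeight R⁺ → RealNumbers.Carrier ℝ)
  (a-expansion : WeylInvariants.Expansion R⁺ (WeylInvariants.monomial R⁺) s a)
  (a-unit : ∀ κ → RealNumbers._≈_ ℝ (a κ κ) (RealNumbers.1# ℝ))
  (b-expansion : WeylInvariants.Expansion R⁺ (D ∘ WeylInvariants.monomial R⁺) s b)
  (b-diagonal : ∀ κ → RealNumbers._≈_ ℝ (b κ κ) (ε κ))
  (regular : ∀ μ κ → WeylInvariants._≺_ R⁺ μ κ → ¬ RealNumbers._≈_ ℝ (ε μ) (ε κ)) where
  open RealNumbers ℝ
  open EuclideanSpace E using (≈ᴹ-trans; ≈ᴹ-sym)
  open Weights R
  open WeylInvariants R⁺ hiding (_,_)
  open InvariantAlgebra R⁺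
  open DominanceOrder R⁺
  private
    module 𝒜 = LeftModule 𝒜ᵂ-leftModule
  open Cofactors commutativeRing using (cofactor)
  open Combinations commutativeRing 𝒜ᵂ-leftModule using (Σⱽ)

  order : DownFinite _≼_
  order = expansion⇒downFinite a-expansion

  a-triangular : TriangularExpansion order monomial s a
  a-triangular = expansion⇒triangular a-expansion (λ {κ} {μ} → s-cong {κ} {μ}) order

  b-triangular : TriangularExpansion order (D ∘ monomial) s b
  b-triangular = expansion⇒triangular b-expansion (λ {κ} {μ} → s-cong {κ} {μ}) order

  -- Inherited from the congruence of `b` along its diagonal.
  ε-cong : ∀ {κ μ} → κ ≈ᴾ μ → ε κ ≈ ε μ
  ε-cong {κ} {μ} p = trans (sym (b-diagonal κ)) (trans (Expansion.r-cong b-expansion p p) (b-diagonal μ))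

  monomial-cong : ∀ {κ μ} → κ ≈ᴾ μ → monomial κ ≈ᴬ monomial μ
  monomial-cong {κ} {μ} = orbitSum-cong {toWeight κ} {toWeight μ}

  module _ {κ : DominantWeight} (e : LinearExtension κ) where
    open LinearExtension e
    open Eigenfunction a b ε e

    private
      module H = HessenbergEigenfunction order {D} D-linear {monomial} {s}
        (λ {κ} {μ} → monomial-cong {κ} {μ}) {a} {b} {ε} (λ {κ} {μ} → ε-cong {κ} {μ})
        a-triangular a-unit b-triangular b-diagonal {κ} (linearExtensionBelow order e)

    -- Regularity makes each factor nonzero: `strictlyBelow k` is not `κ`, since the enumeration is
    -- injective and has `κ` in its last place.
    ℰ-inverse : ℰ ⁻¹ * ℰ ≈ 1#
    ℰ-inverse = trans (*-comm _ _) (⁻¹-inverseʳ (product-nonzero _ factor-nonzero))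
      where
      open RealField ℝ
      open GroupProps +-group using (x∙y⁻¹≈ε⇒x≈y)
      factor-nonzero : ∀ k → ¬ (ε κ - ε (strictlyBelow k) ≈ 0#)
      factor-nonzero k p = regular (strictlyBelow k) κ
        (Enumerates.below enumerates (inject₁ k) , λ k≈κ → Fin.fromℕ≢inject₁
          (≡.sym (Enumerates.injective enumerates (≈ᴹ-trans k≈κ (≈ᴹ-sym last)))))
        (sym (x∙y⁻¹≈ε⇒x≈y _ _ p))

    -- The three cases of the matrix are instances of the single formula for `H.C`: above the
    -- diagonal both `a` and `b` vanish, and on it they are one and the eigenvalue.
    hessenberg-constant : ∀ j k → hessenberg j (suc k) ≈ᴬ constantᴬ (H.C j k)
    hessenberg-constant j k with Fin.<-cmp j (inject₁ k)
    ... | tri< j<k _ _ = 𝒜.≈ᴹ-sym {constantᴬ (H.C j k)} {0ᴬ}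
      (𝒜.≈ᴹ-trans {constantᴬ (H.C j k)} {constantᴬ 0#} {0ᴬ} (constantᴬ-cong (H.C-lower j k j<k))
        (RingMorphisms.IsRingHomomorphism.0#-homo constantᴬ-homo))
    ... | tri≈ _ ≡.refl _ = constantᴬ-cong (sym (H.shifted-diagonal j))
    ... | tri> _ _ _ = 𝒜.≈ᴹ-refl {constantᴬ (d j k)}

    p≈eigenfunction : p ≈ᴬ H.eigenfunction (ℰ ⁻¹) ℰ-inverse
    p≈eigenfunction = 𝒜.*ₗ-congˡ {ℰ ⁻¹} {determinant} {Σⱽ (λ j → cofactor H.C j ∙ᴬ monomial (at j))} (begin
      determinant
        ≈⟨ DeterminantHomomorphism.det-bordered commutativeRing 𝒜ᵂ-commutativeRing constantᴬ-homo
             hessenberg H.C hessenberg-constant ⟩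
      Σⱽ (λ j → constantᴬ (cofactor H.C j) *ᴬ monomial (at j))
        ≈⟨ FiniteSums.∑-cong 𝒜.+ᴹ-commutativeMonoid
             (λ j → constantᴬ (cofactor H.C j) *ᴬ monomial (at j)) (λ j → cofactor H.C j ∙ᴬ monomial (at j))
             (λ j → constant-⊛ (cofactor H.C j) (element (monomial (at j)))) ⟩
      Σⱽ (λ j → cofactor H.C j ∙ᴬ monomial (at j)) ∎)
      where
      open SetoidReasoning 𝒜.≈ᴹ-setoid
      determinant : Invariant
      determinant = Determinant.det 𝒜ᵂ (suc n-1) hessenberg

    p-eigen : D p ≈ᴬ ε κ ∙ᴬ p
    p-eigen = begin
      D p                                            ≈⟨ ⟦⟧-cong {p} {p′} p≈eigenfunction ⟩
      D p′                                           ≈⟨ H.eigen (ℰ ⁻¹) ℰ-inverse ⟩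
      ε κ ∙ᴬ p′                                      ≈⟨ 𝒜.*ₗ-congˡ {ε κ} {p} {p′} p≈eigenfunction ⟨
      ε κ ∙ᴬ p                                       ∎
      where
      open SetoidReasoning 𝒜.≈ᴹ-setoid
      open ModuleMorphisms.LeftModuleMorphisms.IsLeftModuleHomomorphism D-linear using (⟦⟧-cong)
      p′ = H.eigenfunction (ℰ ⁻¹) ℰ-inverse

    p-monic : Σ[ r ∈ (Fin n-1 → Carrier) ] p ≈ᴬ monomial κ +ᴬ combination monomial r strictlyBelow
    p-monic = r , 𝒜.≈ᴹ-trans {p} {H.eigenfunction (ℰ ⁻¹) ℰ-inverse} {monomial κ +ᴬ combination monomial r strictlyBelow}
      p≈eigenfunction (H.eigenfunction-monic (ℰ ⁻¹) ℰ-inverse)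
      where
      r : Fin n-1 → Carrier
      r k = H.coefficients (ℰ ⁻¹) ℰ-inverse (inject₁ k)

    t : DominantWeight → Carrier
    t = H.t (ℰ ⁻¹) ℰ-inverse

    t-congʳ : ∀ {μ ν} → μ ≈ᴾ ν → t μ ≈ t ν
    t-congʳ {μ} {ν} = H.t-congʳ (ℰ ⁻¹) ℰ-inverse {μ} {ν}

    t-zero : ∀ {μ} → ¬ (μ ≼ κ) → t μ ≈ 0#
    t-zero {μ} = H.t-zero (ℰ ⁻¹) ℰ-inverse {μ}

    t-unit : t κ ≈ 1#
    t-unit = H.t-unit (ℰ ⁻¹) ℰ-inverse

    t-expand : ∀ {n} (at′ : Fin n → DominantWeight) → Injective _≡_ _≈ᴾ_ at′ → Covers at′ (_≼ κ) →
               p ≈ᴬ combination s (t ∘ at′) at′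
    t-expand at′ injective covers = 𝒜.≈ᴹ-trans {p} {H.eigenfunction (ℰ ⁻¹) ℰ-inverse} {combination s (t ∘ at′) at′}
      p≈eigenfunction (H.t-expand (ℰ ⁻¹) ℰ-inverse at′ injective covers)

  -- The extensions in `e` serve twice: each determines the coordinates `t (e κ)` of its
  -- eigenfunction in `s`, and together they make `≺` well-founded.
  p-basis : IsBasis s → (e : ∀ κ → LinearExtension κ) → IsBasis (λ κ → Eigenfunction.p a b ε (e κ))
  p-basis s-basis e = unitriangular-basis order {s = s} {t = λ κ → t (e κ)}
    (record { congʳ  = λ κ {μ} {ν} → t-congʳ (e κ) {μ} {ν}
            ; zero⋠  = λ {κ} {μ} → t-zero (e κ) {μ}
            ; expand = λ κ → t-expand (e κ) })
    (λ κ → t-unit (e κ)) (≺-wellFounded e) (λ {κ} {μ} → s-cong {κ} {μ}) s-basis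

mainTheorem1 :
  ∀ {c ℓ₁ ℓ₂ m ℓm : Level}
    (ℝ : RealNumbers c ℓ₁ ℓ₂) (E : EuclideanSpace ℝ m ℓm)
    (R : RootSystem E) → RootSystem.Irreducible R →
    (R⁺ : PositiveSystem R) →
  let open RealNumbers ℝ
      open WeylInvariants R⁺
      open LinearExtension using (n-1)
      open LinearExtension using (strictlyBelow)
  in
  (D : Invariant → Invariant) → IsLinear D → Triangular D →
  (s : DominantWeight → Invariant) → (∀ {κ κ′} → κ ≈ᴾ κ′ → s κ ≈ᴬ s κ′) → IsBasis s →
  (a b : DominantWeight → DominantWeight → Carrier) (ε : DominantWeight → Carrier) →
  Expansion monomial s a → (∀ κ → a κ κ ≈ 1#) →
  Expansion (D ∘ monomial) s b → (∀ κ → b κ κ ≈ ε κ) →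
  (∀ μ κ → μ ≺ κ → ¬ (ε μ ≈ ε κ)) →
  let p : ∀ {κ} → LinearExtension κ → Invariant
      p e = Eigenfunction.p a b ε e
  in
  (∀ κ (e : LinearExtension κ) →
     D (p e) ≈ᴬ ε κ ∙ᴬ p e ×
     Σ[ r ∈ (Fin (n-1 e) → Carrier) ]
       p e ≈ᴬ monomial κ +ᴬ combination monomial r (strictlyBelow e)) ×
  (∀ (e : ∀ κ → LinearExtension κ) → IsBasis (λ κ → p (e κ)))
mainTheorem1 ℝ E R irreducible R⁺ D D-linear D-triangular s s-cong s-basis a b ε
             a-expansion a-unit b-expansion b-diagonal regular =
  (λ κ e → p-eigen e , p-monic e) , p-basis s-basis
  where
  open WeylEigenfunctions R⁺ D D-linear s (λ {κ} {κ′} → s-cong {κ} {κ′}) a b ε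
    a-expansion a-unit b-expansion b-diagonal regular
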